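{- For every $\epsilon\in(0,0.25)$ there exists an absolute constant $C>0$ such that for every finite simple graph $G$ with $n$ vertices and minimum degree $\delta$ satisfying $\delta^{1+\epsilon}\ge n$ (i.e. $\delta\ge n^{1/(1+\epsilon)}$), \[ s(G)\le \frac{n}{\delta}+C . \]
   Context: For a finite simple graph $G$ and a positive integer $k$, a weighting $f:E(G)\to\{1,2,\dots,k\}$ is called $k$-irregular if the weighted degrees $\tilde f(v)=\sum_{u:\{u,v\}\in E(G)} f(\{u,v\})$ are pairwise distinct over all $v\in V(G)$. The irregularity strength $s(G)$ is the least positive integer $k$ for which a $k$-irregular weighting of $G$ exists (and $s(G)=\infty$ if none exists). -}

module Defs where

open import Data.Nat using (ℕ; _≤_; _*_; _+_; _^_; _<_)
open import Data.Bool using (Bool; true; false; if_then_else_)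
open import Data.Fin using (Fin)
open import Data.List using (List; map; allFin)
open import Data.Nat.ListAction using (sum)
open import Data.Product using (_×_; Σ; ∃)
open import Relation.Binary.PropositionalEquality using (_≡_)
open import Relation.Nullary using (¬_)
open import Function.Definitions using (Injective)

record Graph (n : ℕ) : Set where
  field
    adj   : Fin n → Fin n → Bool
    sym   : ∀ i j → adj i j ≡ adj j i
    irrefl : ∀ i → adj i i ≡ false
open Graph public

wdeg : ∀ {n} → Graph n → (Fin n → Fin n → ℕ) → Fin n → ℕ
wdeg G f v = sum (map (λ u → if adj G v u then f v u else 0) (allFin _))

deg : ∀ {n} → Graph n → Fin n → ℕ
deg G v = wdeg G (λ _ _ → 1) v

IsMinDegree : ∀ {n} → Graph n → ℕ → Set
IsMinDegree G δ = (∀ v → δ ≤ deg G v) × ∃ λ v → deg G v ≡ δ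

-- An edge weighting f : E(G) → {1,…,k}, represented as a function on
-- ordered pairs that is symmetric on edges (values off edges are irrelevant).
IsWeighting : ∀ {n} → Graph n → ℕ → (Fin n → Fin n → ℕ) → Set
IsWeighting G k f = ∀ u v → adj G u v ≡ true →
  (f u v ≡ f v u) × (1 ≤ f u v) × (f u v ≤ k)

IsIrregular : ∀ {n} → Graph n → ℕ → (Fin n → Fin n → ℕ) → Set
IsIrregular G k f = IsWeighting G k f × Injective _≡_ _≡_ (wdeg G f)

-- s(G) ≤ x  for a positive integer bound  iff  some k-irregular weighting
-- with 1 ≤ k exists and k satisfies the bound.  The bound s(G) ≤ n/δ + C
-- (δ > 0) is expressed multiplicatively as  k * δ ≤ n + C * δ.

-- Let D be slightly more than n / δ. Each vertex v draws a position x_v in [0, n) and is special with probability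
-- 1 / s, where s is of order D. An edge uv first gets the weight 1 + D [x_u + x_v ≥ n], so that v has weight close to
-- d_v + D d_v x_v / n: the vertices spread over the values with density at most n / (D δ) < 1. A Chernoff bound,
-- derandomized by conditional expectations, keeps every deviation below d_v / κ with κ of order D²; it is here that
-- δ must exceed a multiple of D⁴ log n, which is the hypothesis ε < 1/4.
--
-- The deviation of an ordinary vertex is then smaller than its number of special neighbours, so adding 0 or 1 to the
-- edges towards them moves its weight to a prescribed value. These values are distinct and avoid 0 and 1 modulo M,
-- where M is proportional to D; this costs a fraction 2 / M of the values, hence only a constant added to D.
--
-- Finally the special vertices are treated one after another as in the argument of Kalkowski, Karoński and Pfender,
-- changing only edges between special vertices: each of them gets a weight congruent to 0 or 1 modulo M that differs
-- from those of the previous special vertices. Few special vertices have nearby weights, so there is always room.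
--
-- Graphs of bounded minimum degree have boundedly many vertices, and powers of n + 1 serve as weights.
module Submission where

open import Defs hiding (sym)
open import Data.Nat hiding (_≟_; _≤?_; _<?_)
import Data.Nat as ℕ
open import Data.Nat.Properties
open import Data.Nat.DivMod using (_/_; _%_; m≡m%n+[m/n]*n; m%n<n; m<n*o⇒m/o<n; [m+kn]%n≡m%n; m<n⇒m%n≡m; m/n≤m; m≥n⇒m/n>0)
open import Data.Nat.Divisibility using (_∣_; ∣n⇒∣m*n; ∣m⇒∣m*n; ∣-refl)
open import Data.Nat.ListAction using (sum)
open import Data.Nat.Tactic.RingSolver using (solve-∀)
open import Data.Bool using (Bool; true; false; if_then_else_; _∧_; not)
open import Data.Bool.Properties using (∧-comm; ∧-identityʳ; ∧-zeroʳ)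
open import Data.Fin using (Fin; zero; suc; toℕ; fromℕ<; combine; remQuot)
open import Data.Fin.Properties using (toℕ-injective; toℕ<n; toℕ-fromℕ<; remQuot-combine) renaming (_≟_ to _≟ᶠ_; suc-injective to sucᶠ-injective)
open import Data.List using (tabulate)
open import Data.List.Properties using (map-tabulate)
open import Data.Product using (Σ; ∃; ∃₂; _×_; _,_; proj₁; proj₂)
open import Data.Sum using (_⊎_; inj₁; inj₂)
open import Data.Vec.Functional using (_∷_)
open import Data.Empty using (⊥; ⊥-elim)
open import Relation.Nullary using (Dec; yes; no; does)
open import Relation.Nullary.Decidable using (dec-true; dec-false)
open import Relation.Binary.Definitions using (Tri; tri<; tri≈; tri>)
open import Relation.Binary.PropositionalEquality using (_≡_; _≢_; refl; sym; trans; cong; cong₂; subst; subst₂; module ≡-Reasoning)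
open import Function using (_∘_; id)
import Algebra.Properties.Semiring.Sum +-*-semiring as Sum
import Algebra.Properties.CommutativeMonoid.Sum *-1-commutativeMonoid as Product

-- Why the orders of magnitude are forced. An edge between special vertices may end up anywhere
-- between 1 and about `D`, so the special edges at `v` stay harmless only if there are at most
-- about `d v / D` of them; hence `s` of order `D`. An ordinary vertex then has about `d v / s`
-- special neighbours to absorb its error, while a miscount of `d v / κ` heavy edges shifts its
-- weight by `D * d v / κ`; hence `κ = 16 * (D * s)`. A relative error `1 / κ` costs degree
-- `κ² log n` in a Chernoff bound. There are no reals: ε is `p / q`, probabilities are counts over
-- the `s * n` choices of a vertex, and exponentials are powers of `1 + 1/ℓ`. Only upper tails are
-- proved; lower tails come from complementary events. The constant 108 is 3 times 36: each near
-- special vertex forbids three values, and there are at most 36 times as many near special vertices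
-- as special neighbours. It bounds `L = T / M`, the number of multiples of `M` gained with each
-- unit of the upper digit.

∑ : ∀ {n} → (Fin n → ℕ) → ℕ
∑ = Sum.sum

∏ : ∀ {n} → (Fin n → ℕ) → ℕ
∏ = Product.sum

[_] : Bool → ℕ
[ b ] = if b then 1 else 0

# : ∀ {n} → (Fin n → Bool) → ℕ
# p = ∑ (λ u → [ p u ])

-- Finite sums and products

∑-cong : ∀ {n} {f g : Fin n → ℕ} → (∀ i → f i ≡ g i) → ∑ f ≡ ∑ g
∑-cong = Sum.sum-cong-≗

∑-+ : ∀ {n} (f g : Fin n → ℕ) → ∑ (λ i → f i + g i) ≡ ∑ f + ∑ g
∑-+ = Sum.∑-distrib-+

∑-*ˡ : ∀ {n} c (f : Fin n → ℕ) → ∑ (λ i → c * f i) ≡ c * ∑ f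
∑-*ˡ c f = sym (Sum.*-distribˡ-sum c f)

∑-*ʳ : ∀ {n} c (f : Fin n → ℕ) → ∑ (λ i → f i * c) ≡ ∑ f * c
∑-*ʳ c f = sym (Sum.*-distribʳ-sum c f)

∑-const : ∀ n c → ∑ {n} (λ _ → c) ≡ n * c
∑-const zero c = refl
∑-const (suc n) c = cong (c +_) (∑-const n c)

∑-mono : ∀ {n} {f g : Fin n → ℕ} → (∀ i → f i ≤ g i) → ∑ f ≤ ∑ g
∑-mono {zero} h = z≤n
∑-mono {suc n} h = +-mono-≤ (h zero) (∑-mono (h ∘ suc))

∑-bound : ∀ {n} {f : Fin n → ℕ} {c} → (∀ i → f i ≤ c) → ∑ f ≤ n * c
∑-bound {n} {c = c} h = ≤-trans (∑-mono h) (≤-reflexive (∑-const n c))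

term≤∑ : ∀ {n} (f : Fin n → ℕ) i → f i ≤ ∑ f
term≤∑ f zero = m≤m+n _ _
term≤∑ f (suc i) = ≤-trans (term≤∑ (f ∘ suc) i) (m≤n+m _ _)

∑-update : ∀ {n} (f g : Fin n → ℕ) i → (∀ j → j ≢ i → f j ≡ g j) → f i + ∑ g ≡ g i + ∑ f
∑-update f g zero h = begin
  f zero + (g zero + ∑ (g ∘ suc)) ≡⟨ cong (λ z → f zero + (g zero + z)) (∑-cong λ j → sym (h (suc j) λ ())) ⟩
  f zero + (g zero + ∑ (f ∘ suc)) ≡⟨ lem (f zero) (g zero) _ ⟩
  g zero + (f zero + ∑ (f ∘ suc)) ∎
  where
  open ≡-Reasoning
  lem : ∀ a b c → a + (b + c) ≡ b + (a + c)
  lem = solve-∀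
∑-update f g (suc i) h = begin
  f (suc i) + (g zero + ∑ (g ∘ suc)) ≡⟨ lem (f (suc i)) (g zero) _ ⟩
  g zero + (f (suc i) + ∑ (g ∘ suc)) ≡⟨ cong₂ _+_ (sym (h zero λ ())) (∑-update (f ∘ suc) (g ∘ suc) i (λ j ne → h (suc j) (λ e → ne (sucᶠ-injective e)))) ⟩
  f zero + (g (suc i) + ∑ (f ∘ suc)) ≡⟨ lem (f zero) (g (suc i)) _ ⟩
  g (suc i) + (f zero + ∑ (f ∘ suc)) ∎
  where
  open ≡-Reasoning
  lem : ∀ a b c → a + (b + c) ≡ b + (a + c)
  lem = solve-∀

factor∣∏ : ∀ {n} (f : Fin n → ℕ) i → f i ∣ ∏ f
factor∣∏ f zero = ∣m⇒∣m*n _ ∣-refl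
factor∣∏ f (suc i) = ∣n⇒∣m*n (f zero) (factor∣∏ (f ∘ suc) i)

∏-positive : ∀ {n} (f : Fin n → ℕ) → (∀ i → 1 ≤ f i) → 1 ≤ ∏ f
∏-positive {zero} f h = ≤-refl
∏-positive {suc n} f h = *-mono-≤ (h zero) (∏-positive (f ∘ suc) (h ∘ suc))

-- Averaging and the method of conditional expectations

some-below-average : ∀ n → 1 ≤ n → (g : Fin n → ℕ) → ∃ λ i → n * g i ≤ ∑ g
some-below-average (suc zero) _ g = zero , ≤-refl
some-below-average (suc (suc n)) _ g with some-below-average (suc n) (s≤s z≤n) (g ∘ suc)
... | i , h with ≤-total (g zero) (g (suc i))
...   | inj₁ le = zero , +-monoʳ-≤ (g zero) (≤-trans (*-monoʳ-≤ (suc n) le) h)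
...   | inj₂ le = suc i , +-mono-≤ le h

some-below-average₂ : ∀ s m → 1 ≤ s → 1 ≤ m → (g : Fin s → Fin m → ℕ) →
  ∃₂ λ y x → s * m * g y x ≤ ∑ (λ y → ∑ (g y))
some-below-average₂ s m 1≤s 1≤m g with some-below-average s 1≤s (λ y → ∑ (g y))
... | y , h₁ with some-below-average m 1≤m (g y)
...   | x , h₂ = y , x , ≤-trans (≤-reflexive (*-assoc s m _)) (≤-trans (*-monoʳ-≤ s h₂) h₁)

-- Fixing the choice of the first vertex at or below the average multiplies the `i`-th term by a
-- known factor, which joins `w i`. The induction therefore needs arbitrary weights `w`.
derandomize : ∀ n {N s m} → 1 ≤ s → 1 ≤ m → (w : Fin N → ℕ) (F : Fin N → Fin n → Fin s → Fin m → ℕ) →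
  ∃₂ λ (y : Fin n → Fin s) (x : Fin n → Fin m) →
    (s * m) ^ n * ∑ (λ i → w i * ∏ (λ u → F i u (y u) (x u)))
      ≤ ∑ (λ i → w i * ∏ (λ u → ∑ (λ y → ∑ (F i u y))))
derandomize zero _ _ w F = (λ ()) , (λ ()) , ≤-reflexive (*-identityˡ _)
derandomize (suc n) {N} {s} {m} 1≤s 1≤m w F
  with some-below-average₂ s m 1≤s 1≤m (λ y x → ∑ (λ i → w i * F i zero y x * ∏ (λ u → ∑ (λ y → ∑ (F i (suc u) y)))))
... | y₀ , x₀ , h₀
  with derandomize n 1≤s 1≤m (λ i → w i * F i zero y₀ x₀) (λ i u → F i (suc u))
... | y , x , h = y₀ ∷ y , x₀ ∷ x , (begin
    s * m * (s * m) ^ n * ∑ (λ i → w i * (F i zero y₀ x₀ * ∏ (λ u → F i (suc u) (y u) (x u))))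
      ≡⟨ *-assoc (s * m) _ _ ⟩
    s * m * ((s * m) ^ n * ∑ (λ i → w i * (F i zero y₀ x₀ * ∏ (λ u → F i (suc u) (y u) (x u)))))
      ≡⟨ cong (λ z → s * m * ((s * m) ^ n * z)) (∑-cong λ i → sym (*-assoc (w i) _ _)) ⟩
    s * m * ((s * m) ^ n * ∑ (λ i → w i * F i zero y₀ x₀ * ∏ (λ u → F i (suc u) (y u) (x u))))
      ≤⟨ *-monoʳ-≤ (s * m) h ⟩
    s * m * ∑ (λ i → w i * F i zero y₀ x₀ * R i)
      ≤⟨ h₀ ⟩
    ∑ (λ y → ∑ (λ x → ∑ (λ i → w i * F i zero y x * R i)))
      ≡⟨ ∑-cong (λ y → Sum.∑-comm (λ x i → w i * F i zero y x * R i)) ⟩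
    ∑ (λ y → ∑ (λ i → ∑ (λ x → w i * F i zero y x * R i)))
      ≡⟨ Sum.∑-comm (λ y i → ∑ (λ x → w i * F i zero y x * R i)) ⟩
    ∑ (λ i → ∑ (λ y → ∑ (λ x → w i * F i zero y x * R i)))
      ≡⟨ ∑-cong pull ⟩
    ∑ (λ i → w i * (∑ (λ y → ∑ (F i zero y)) * R i)) ∎)
  where
  open ≤-Reasoning
  R : Fin N → ℕ
  R i = ∏ (λ u → ∑ (λ y → ∑ (F i (suc u) y)))
  lem : ∀ a b c → a * b * c ≡ a * c * b
  lem = solve-∀
  lem′ : ∀ a b c → a * b * c ≡ a * (c * b)
  lem′ = solve-∀
  pull : ∀ i → ∑ (λ y → ∑ (λ x → w i * F i zero y x * R i)) ≡ w i * (∑ (λ y → ∑ (F i zero y)) * R i)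
  pull i = trans (∑-cong λ y → trans (∑-cong λ x → lem (w i) (F i zero y x) (R i)) (∑-*ˡ (w i * R i) (F i zero y)))
          (trans (∑-*ˡ (w i * R i) (λ y → ∑ (F i zero y))) (lem′ (w i) (R i) _))

^-distribʳ-* : ∀ a b k → (a * b) ^ k ≡ a ^ k * b ^ k
^-distribʳ-* a b zero = refl
^-distribʳ-* a b (suc k) = trans (cong (a * b *_) (^-distribʳ-* a b k)) (lem a b (a ^ k) (b ^ k))
  where
  lem : ∀ a b c d → a * b * (c * d) ≡ a * c * (b * d)
  lem = solve-∀

-- a / b ≤ c / d, cross-multiplied; meaningful for positive denominators only.
-- A Chernoff bound in integer arithmetic

infix 4 _÷_⊑_÷_
_÷_⊑_÷_ : ℕ → ℕ → ℕ → ℕ → Set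
a ÷ b ⊑ c ÷ d = a * d ≤ c * b

⊑-trans : ∀ a b c d e f .{{_ : NonZero d}} → a ÷ b ⊑ c ÷ d → c ÷ d ⊑ e ÷ f → a ÷ b ⊑ e ÷ f
⊑-trans a b c d e f h₁ h₂ = *-cancelʳ-≤ (a * f) (e * b) d (begin
  a * f * d ≡⟨ lem a f d ⟩
  a * d * f ≤⟨ *-monoˡ-≤ f h₁ ⟩
  c * b * f ≡⟨ lem c b f ⟩
  c * f * b ≤⟨ *-monoˡ-≤ b h₂ ⟩
  e * d * b ≡⟨ lem e d b ⟩
  e * b * d ∎)
  where
  open ≤-Reasoning
  lem : ∀ x y z → x * y * z ≡ x * z * y
  lem = solve-∀

⊑-* : ∀ a b c d a′ b′ c′ d′ → a ÷ b ⊑ c ÷ d → a′ ÷ b′ ⊑ c′ ÷ d′ → a * a′ ÷ b * b′ ⊑ c * c′ ÷ d * d′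
⊑-* a b c d a′ b′ c′ d′ h h′ = begin
  a * a′ * (d * d′)   ≡⟨ lem a a′ d d′ ⟩
  a * d * (a′ * d′)   ≤⟨ *-mono-≤ h h′ ⟩
  c * b * (c′ * b′)   ≡⟨ lem c b c′ b′ ⟩
  c * c′ * (b * b′) ∎
  where
  open ≤-Reasoning
  lem : ∀ x y z w → x * y * (z * w) ≡ x * z * (y * w)
  lem = solve-∀

⊑-^ : ∀ a b c d k → a ÷ b ⊑ c ÷ d → a ^ k ÷ b ^ k ⊑ c ^ k ÷ d ^ k
⊑-^ a b c d k h = subst₂ _≤_ (^-distribʳ-* a d k) (^-distribʳ-* c b k) (^-monoˡ-≤ k h)

bernoulli : ∀ K a → (K + a) * K ^ a ≤ K * suc K ^ a
bernoulli K zero = ≤-reflexive (cong (_* 1) (+-identityʳ K))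
bernoulli K (suc a) = begin
  (K + suc a) * (K * K ^ a)     ≡⟨ *-assoc (K + suc a) K (K ^ a) ⟨
  (K + suc a) * K * K ^ a       ≤⟨ *-monoˡ-≤ (K ^ a) (≤-trans (m≤m+n _ a) (≤-reflexive (lem K a))) ⟩
  suc K * (K + a) * K ^ a       ≡⟨ *-assoc (suc K) (K + a) (K ^ a) ⟩
  suc K * ((K + a) * K ^ a)     ≤⟨ *-monoʳ-≤ (suc K) (bernoulli K a) ⟩
  suc K * (K * suc K ^ a)       ≡⟨ lem′ (suc K) K (suc K ^ a) ⟩
  K * (suc K * suc K ^ a) ∎
  where
  open ≤-Reasoning
  lem : ∀ K a → (K + suc a) * K + a ≡ suc K * (K + a)
  lem = solve-∀
  lem′ : ∀ a b c → a * (b * c) ≡ b * (a * c)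
  lem′ = solve-∀

-- With `K = c + j` this reads `(1 + 1/K) ^ j ≤ 1 / (1 - j/K)`: an upper bound on powers of
-- `1 + 1/K`, complementing the lower bound in `bernoulli`.
bernoulli⁻ : ∀ c j → suc (c + j) ^ j * c ≤ (c + j) * (c + j) ^ j
bernoulli⁻ c zero = ≤-reflexive (lem c)
  where
  lem : ∀ c → 1 * c ≡ (c + 0) * 1
  lem = solve-∀
bernoulli⁻ c (suc j) = *-cancelˡ-≤ (suc c) (begin
  suc c * (suc K * suc K ^ j * c)        ≡⟨ lem c (suc K) (suc K ^ j) ⟩
  (suc K ^ j * suc c) * (suc K * c)      ≤⟨ *-monoˡ-≤ (suc K * c) ih ⟩
  (K * K ^ j) * (suc K * c)              ≤⟨ *-monoʳ-≤ (K * K ^ j) (≤-trans (m≤m+n _ (suc j)) (≤-reflexive (lem′ c j))) ⟩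
  (K * K ^ j) * (suc c * K)              ≡⟨ lem″ K (K ^ j) (suc c) ⟩
  suc c * (K * (K * K ^ j)) ∎)
  where
  open ≤-Reasoning
  K = c + suc j
  ih : suc K ^ j * suc c ≤ K * K ^ j
  ih = subst (λ K → suc K ^ j * suc c ≤ K * K ^ j) (sym (+-suc c j)) (bernoulli⁻ (suc c) j)
  lem : ∀ c a b → suc c * (a * b * c) ≡ (b * suc c) * (a * c)
  lem = solve-∀
  lem′ : ∀ c j → suc (c + suc j) * c + suc j ≡ suc c * (c + suc j)
  lem′ = solve-∀
  lem″ : ∀ a b c → a * b * (c * a) ≡ c * (a * (a * b))
  lem″ = solve-∀

-- Replaces taking logarithms to base `1 + 1/l`.
exponent-≤ : ∀ l a b .{{_ : NonZero l}} → suc l ^ a ÷ l ^ a ⊑ suc l ^ b ÷ l ^ b → a ≤ b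
exponent-≤ l a b h with a ℕ.≤? b
... | yes a≤b = a≤b
... | no a≰b with m≤n⇒∃[o]m+o≡n (≰⇒> a≰b)
...   | c , refl = ⊥-elim (<⇒≱ (^-monoˡ-< (suc c) (n<1+n l)) (*-cancelˡ-≤ (suc l ^ b * l ^ b) {{m*n≢0 _ _ {{m^n≢0 (suc l) b}} {{m^n≢0 l b}}}} (begin
    suc l ^ b * l ^ b * suc l ^ suc c       ≡⟨ lem (suc l ^ b) (l ^ b) (suc l ^ suc c) ⟩
    (suc l ^ b * suc l ^ suc c) * l ^ b     ≡⟨ cong (_* l ^ b) (^-distribˡ-+-* (suc l) b (suc c)) ⟨
    suc l ^ (b + suc c) * l ^ b             ≤⟨ subst (λ z → suc l ^ z * l ^ b ≤ suc l ^ b * l ^ z) (sym (+-suc b c)) h ⟩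
    suc l ^ b * l ^ (b + suc c)             ≡⟨ cong (suc l ^ b *_) (^-distribˡ-+-* l b (suc c)) ⟩
    suc l ^ b * (l ^ b * l ^ suc c)         ≡⟨ *-assoc (suc l ^ b) _ _ ⟨
    suc l ^ b * l ^ b * l ^ suc c ∎)))
  where
  open ≤-Reasoning
  lem : ∀ x y z → x * y * z ≡ (x * z) * y
  lem = solve-∀

-- The product is the exponential `(1 + 1/ℓ) ^ # b` used in the Chernoff argument, scaled by `ℓ` at
-- every vertex to stay integral.
∏-tilted : ∀ {n} ℓ (b : Fin n → Bool) → ∏ (λ u → ℓ + [ b u ]) * ℓ ^ # b ≡ ℓ ^ n * suc ℓ ^ # b
∏-tilted {zero} ℓ b = refl
∏-tilted {suc n} ℓ b with b zero | ∏-tilted ℓ (b ∘ suc)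
... | false | ih = begin
    (ℓ + 0) * p * q          ≡⟨ lem ℓ p q ⟩
    ℓ * (p * q)              ≡⟨ cong (ℓ *_) ih ⟩
    ℓ * (ℓ ^ n * r)          ≡⟨ *-assoc ℓ _ _ ⟨
    ℓ * ℓ ^ n * r ∎
  where
  open ≡-Reasoning
  p = ∏ (λ u → ℓ + [ b (suc u) ])
  q = ℓ ^ # (b ∘ suc)
  r = suc ℓ ^ # (b ∘ suc)
  lem : ∀ a b c → (a + 0) * b * c ≡ a * (b * c)
  lem = solve-∀
... | true | ih = begin
    (ℓ + 1) * p * (ℓ * q)            ≡⟨ lem ℓ p q ⟩
    ℓ * suc ℓ * (p * q)              ≡⟨ cong (ℓ * suc ℓ *_) ih ⟩
    ℓ * suc ℓ * (ℓ ^ n * r)          ≡⟨ lem′ ℓ (suc ℓ) _ _ ⟩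
    ℓ * ℓ ^ n * (suc ℓ * r) ∎
  where
  open ≡-Reasoning
  p = ∏ (λ u → ℓ + [ b (suc u) ])
  q = ℓ ^ # (b ∘ suc)
  r = suc ℓ ^ # (b ∘ suc)
  lem : ∀ a b c → (a + 1) * b * (a * c) ≡ a * suc a * (b * c)
  lem = solve-∀
  lem′ : ∀ a b c d → a * b * (c * d) ≡ a * c * (b * d)
  lem′ = solve-∀

-- Takes the place of the estimate of `1 + x` by the exponential of `x`: each factor `1 + a u / K`
-- is at most `(1 + 1/K) ^ a u`, so the product depends only on the sum.
∏-bernoulli : ∀ {n} K (a : Fin n → ℕ) → ∏ (λ u → K + a u) * K ^ ∑ a ≤ K ^ n * suc K ^ ∑ a
∏-bernoulli {zero} K a = ≤-refl
∏-bernoulli {suc n} K a = begin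
  (K + a₀) * p * K ^ (a₀ + A)                ≡⟨ cong ((K + a₀) * p *_) (^-distribˡ-+-* K a₀ A) ⟩
  (K + a₀) * p * (K ^ a₀ * K ^ A)            ≡⟨ lem (K + a₀) p (K ^ a₀) (K ^ A) ⟩
  (K + a₀) * K ^ a₀ * (p * K ^ A)            ≤⟨ *-mono-≤ (bernoulli K a₀) (∏-bernoulli K (a ∘ suc)) ⟩
  K * suc K ^ a₀ * (K ^ n * suc K ^ A)       ≡⟨ lem K (suc K ^ a₀) (K ^ n) (suc K ^ A) ⟩
  K * K ^ n * (suc K ^ a₀ * suc K ^ A)       ≡⟨ cong (K * K ^ n *_) (^-distribˡ-+-* (suc K) a₀ A) ⟨
  K * K ^ n * suc K ^ (a₀ + A) ∎
  where
  open ≤-Reasoning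
  a₀ = a zero
  A = ∑ (a ∘ suc)
  p = ∏ (λ u → K + a (suc u))
  lem : ∀ a b c d → a * b * (c * d) ≡ a * c * (b * d)
  lem = solve-∀

-- Dividing by `(suc ℓ / ℓ) ^ ℓ` leaves `(ℓ² / (ℓ² - 1)) ^ ℓ ≤ (1 + 1/ℓ)²`, because
-- `suc ℓ * l = ℓ² - 1 = c + ℓ`. By `bernoulli⁻` the left side is at most `(c + ℓ) / c`, and `gap`
-- does the rest.
ratio-above-e′ : ∀ l ℓ c .{{_ : NonZero c}} → ℓ * ℓ ≡ suc (c + ℓ) → suc ℓ * l ≡ c + ℓ →
  (c + ℓ) * ℓ ^ 2 ≤ c * suc ℓ ^ 2 → ℓ ^ ℓ ÷ l ^ ℓ ⊑ suc ℓ ^ (ℓ + 2) ÷ ℓ ^ (ℓ + 2)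
ratio-above-e′ l ℓ c square neighbours gap = *-cancelˡ-≤ c (begin
    c * (ℓ ^ ℓ * ℓ ^ (ℓ + 2))                     ≡⟨ cong (λ z → c * (ℓ ^ ℓ * z)) (^-distribˡ-+-* ℓ ℓ 2) ⟩
    c * (ℓ ^ ℓ * (ℓ ^ ℓ * ℓ ^ 2))                 ≡⟨ lem c (ℓ ^ ℓ) (ℓ ^ 2) ⟩
    (ℓ ^ ℓ * ℓ ^ ℓ) * c * ℓ ^ 2                   ≡⟨ cong (λ z → z * c * ℓ ^ 2) (^-distribʳ-* ℓ ℓ ℓ) ⟨
    (ℓ * ℓ) ^ ℓ * c * ℓ ^ 2                       ≡⟨ cong (λ z → z ^ ℓ * c * ℓ ^ 2) square ⟩
    suc (c + ℓ) ^ ℓ * c * ℓ ^ 2                   ≤⟨ *-monoˡ-≤ (ℓ ^ 2) (bernoulli⁻ c ℓ) ⟩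
    (c + ℓ) * (c + ℓ) ^ ℓ * ℓ ^ 2                 ≡⟨ lem″ (c + ℓ) ((c + ℓ) ^ ℓ) (ℓ ^ 2) ⟩
    (c + ℓ) * ℓ ^ 2 * (c + ℓ) ^ ℓ                 ≤⟨ *-monoˡ-≤ ((c + ℓ) ^ ℓ) gap ⟩
    c * suc ℓ ^ 2 * (c + ℓ) ^ ℓ                   ≡⟨ cong (λ z → c * suc ℓ ^ 2 * z ^ ℓ) neighbours ⟨
    c * suc ℓ ^ 2 * (suc ℓ * l) ^ ℓ               ≡⟨ cong (c * suc ℓ ^ 2 *_) (^-distribʳ-* (suc ℓ) l ℓ) ⟩
    c * suc ℓ ^ 2 * (suc ℓ ^ ℓ * l ^ ℓ)           ≡⟨ lem‴ c (suc ℓ ^ 2) (suc ℓ ^ ℓ) (l ^ ℓ) ⟩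
    c * (suc ℓ ^ ℓ * suc ℓ ^ 2 * l ^ ℓ)           ≡⟨ cong (λ z → c * (z * l ^ ℓ)) (^-distribˡ-+-* (suc ℓ) ℓ 2) ⟨
    c * (suc ℓ ^ (ℓ + 2) * l ^ ℓ) ∎)
  where
  open ≤-Reasoning
  lem : ∀ c a b → c * (a * (a * b)) ≡ (a * a) * c * b
  lem = solve-∀
  lem″ : ∀ a b c → a * b * c ≡ a * c * b
  lem″ = solve-∀
  lem‴ : ∀ c a b d → c * a * (b * d) ≡ c * (b * a * d)
  lem‴ = solve-∀

-- The left side slightly exceeds Euler's number. Expressing it in base `1 + 1/ℓ` costs the exponent
-- `ℓ + 2` instead of `ℓ`; this relative loss `2 / ℓ` is one of the two sources of the error in
-- `deviation`.
ratio-above-e : ∀ l ℓ → ℓ ≡ suc l → 3 ≤ l → ℓ ^ ℓ ÷ l ^ ℓ ⊑ suc ℓ ^ (ℓ + 2) ÷ ℓ ^ (ℓ + 2)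
ratio-above-e l ℓ ℓ≡ 3≤l = ratio-above-e′ l ℓ c (trans (cong₂ _*_ ℓ≡′ ℓ≡′) (trans (square j) (cong (λ z → suc (c + z)) (sym ℓ≡′))))
  (trans (cong₂ (λ a b → suc a * b) ℓ≡′ l≡) (trans (neighbours j) (cong (c +_) (sym ℓ≡′))))
  (subst (λ z → (c + z) * z ^ 2 ≤ c * suc z ^ 2) (sym ℓ≡′) (≤-trans (m≤m+n _ _) (≤-reflexive (gap j))))
  where
  j = l ∸ 3
  -- This is `ℓ² - 1 - ℓ` at `ℓ = 4 + j`.
  c = 11 + 7 * j + j * j
  l≡ : l ≡ 3 + j
  l≡ = sym (m+[n∸m]≡n 3≤l)
  ℓ≡′ : ℓ ≡ 4 + j
  ℓ≡′ = trans ℓ≡ (cong suc l≡)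
  square : ∀ j → (4 + j) * (4 + j) ≡ suc (11 + 7 * j + j * j + (4 + j))
  square = solve-∀
  neighbours : ∀ j → (5 + j) * (3 + j) ≡ 11 + 7 * j + j * j + (4 + j)
  neighbours = solve-∀
  gap : ∀ j → (11 + 7 * j + j * j + (4 + j)) * ((4 + j) * ((4 + j) * 1)) + (5 + j) * (7 + 6 * j + j * j)
    ≡ (11 + 7 * j + j * j) * ((5 + j) * ((5 + j) * 1))
  gap = solve-∀

-- Y is the count, A ÷ P its expectation and N the number of events in the union bound.
tail-exponent : ∀ l ℓ P N g Y A → ℓ ≡ suc l → 3 ≤ l → 1 ≤ P → N ≤ 2 ^ g → let K = ℓ * P in
  suc ℓ ^ Y ÷ ℓ ^ Y ⊑ N * suc K ^ A ÷ K ^ A →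
  Y * (P * ℓ) ≤ ℓ * (g * (P * ℓ)) + (ℓ + 2) * A
tail-exponent l ℓ P N g Y A ℓ≡ 3≤l 1≤P N≤2^g h =
  exponent-≤ ℓ _ _ (⊑-trans (suc ℓ ^ (Y * k)) (ℓ ^ (Y * k)) (N ^ k * suc K ^ (A * k)) (1 * K ^ (A * k)) (suc ℓ ^ (ℓ * (g * k) + (ℓ + 2) * A)) (ℓ ^ (ℓ * (g * k) + (ℓ + 2) * A)) {{nz}} step₁
    (subst₂ (λ p q → N ^ k * suc K ^ (A * k) ÷ 1 * K ^ (A * k) ⊑ p ÷ q)
      (sym (^-distribˡ-+-* (suc ℓ) (ℓ * (g * k)) ((ℓ + 2) * A)))
      (sym (^-distribˡ-+-* ℓ (ℓ * (g * k)) ((ℓ + 2) * A)))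
      (⊑-* (N ^ k) 1 (suc ℓ ^ (ℓ * (g * k))) (ℓ ^ (ℓ * (g * k))) (suc K ^ (A * k)) (K ^ (A * k)) (suc ℓ ^ ((ℓ + 2) * A)) (ℓ ^ ((ℓ + 2) * A)) step₂ step₃)))
  where
  K = ℓ * P
  -- Equal to `K`: raising to this power turns `(1 + 1/K) ^ A` into roughly the exponential of `A`,
  -- which `ratio-above-e` compares with powers of `1 + 1/ℓ`.
  k = P * ℓ
  instance
    nzP : NonZero P
    nzP = >-nonZero 1≤P
    nzl : NonZero l
    nzl = >-nonZero (≤-trans (s≤s z≤n) 3≤l)
    nzℓ : NonZero ℓ
    nzℓ = subst NonZero (sym ℓ≡) _
    nzK : NonZero K
    nzK = m*n≢0 ℓ P
  nz : NonZero (1 * K ^ (A * k))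
  nz = m*n≢0 1 _ {{_}} {{m^n≢0 K (A * k)}}
  step₁ : suc ℓ ^ (Y * k) ÷ ℓ ^ (Y * k) ⊑ N ^ k * suc K ^ (A * k) ÷ 1 * K ^ (A * k)
  step₁ = subst₂ _≤_ eqˡ eqʳ (⊑-^ (suc ℓ ^ Y) (ℓ ^ Y) (N * suc K ^ A) (K ^ A) k h)
    where
    eqˡ : (suc ℓ ^ Y) ^ k * (K ^ A) ^ k ≡ suc ℓ ^ (Y * k) * (1 * K ^ (A * k))
    eqˡ = cong₂ _*_ (^-*-assoc (suc ℓ) Y k) (trans (^-*-assoc K A k) (sym (*-identityˡ _)))
    eqʳ : (N * suc K ^ A) ^ k * (ℓ ^ Y) ^ k ≡ N ^ k * suc K ^ (A * k) * ℓ ^ (Y * k)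
    eqʳ = cong₂ _*_ (trans (^-distribʳ-* N _ k) (cong (N ^ k *_) (^-*-assoc (suc K) A k))) (^-*-assoc ℓ Y k)
  -- A factor 2 of the union bound costs at most `ℓ` in the exponent, so `N ≤ 2 ^ g` costs `ℓ * g`.
  two : 2 ÷ 1 ⊑ suc ℓ ^ ℓ ÷ ℓ ^ ℓ
  two = *-cancelˡ-≤ ℓ (subst₂ _≤_ (lem ℓ (ℓ ^ ℓ)) (lem′ ℓ (suc ℓ ^ ℓ)) (bernoulli ℓ ℓ))
    where
    lem : ∀ a b → (a + a) * b ≡ a * (2 * b)
    lem = solve-∀
    lem′ : ∀ a b → a * b ≡ a * (b * 1)
    lem′ = solve-∀
  step₂ : N ^ k ÷ 1 ⊑ suc ℓ ^ (ℓ * (g * k)) ÷ ℓ ^ (ℓ * (g * k))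
  step₂ = begin
    N ^ k * ℓ ^ (ℓ * (g * k))         ≤⟨ *-monoˡ-≤ _ (^-monoˡ-≤ k N≤2^g) ⟩
    (2 ^ g) ^ k * ℓ ^ (ℓ * (g * k))   ≡⟨ cong₂ _*_ (^-*-assoc 2 g k) (sym (^-*-assoc ℓ ℓ (g * k))) ⟩
    2 ^ (g * k) * (ℓ ^ ℓ) ^ (g * k)   ≤⟨ ⊑-^ 2 1 (suc ℓ ^ ℓ) (ℓ ^ ℓ) (g * k) two ⟩
    (suc ℓ ^ ℓ) ^ (g * k) * 1 ^ (g * k) ≡⟨ cong₂ _*_ (^-*-assoc (suc ℓ) ℓ (g * k)) (^-zeroˡ (g * k)) ⟩
    suc ℓ ^ (ℓ * (g * k)) * 1 ∎
    where open ≤-Reasoning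
  above : suc K ^ P ÷ K ^ P ⊑ ℓ ÷ l
  above = *-cancelˡ-≤ P (begin
    P * (suc K ^ P * l)     ≡⟨ lem P (suc K ^ P) l ⟩
    suc K ^ P * (l * P)     ≤⟨ subst (λ z → suc z ^ P * (l * P) ≤ z * z ^ P) (trans (+-comm (l * P) P) (cong (_* P) (sym ℓ≡))) (bernoulli⁻ (l * P) P) ⟩
    ℓ * P * K ^ P           ≡⟨ lem′ ℓ P (K ^ P) ⟩
    P * (ℓ * K ^ P) ∎)
    where
    open ≤-Reasoning
    lem : ∀ a b c → a * (b * c) ≡ b * (c * a)
    lem = solve-∀
    lem′ : ∀ a b c → a * b * c ≡ b * (a * c)
    lem′ = solve-∀
  step₃ : suc K ^ (A * k) ÷ K ^ (A * k) ⊑ suc ℓ ^ ((ℓ + 2) * A) ÷ ℓ ^ ((ℓ + 2) * A)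
  step₃ = ⊑-trans (suc K ^ (A * k)) (K ^ (A * k)) (ℓ ^ (ℓ * A)) (l ^ (ℓ * A)) (suc ℓ ^ ((ℓ + 2) * A)) (ℓ ^ ((ℓ + 2) * A)) {{m^n≢0 l (ℓ * A)}}
    (subst (λ p → suc K ^ p ÷ K ^ p ⊑ ℓ ^ (ℓ * A) ÷ l ^ (ℓ * A)) (lem P ℓ A)
      (subst₂ _≤_ (cong (_* l ^ (ℓ * A)) (^-*-assoc (suc K) P (ℓ * A))) (cong (ℓ ^ (ℓ * A) *_) (^-*-assoc K P (ℓ * A)))
        (⊑-^ (suc K ^ P) (K ^ P) ℓ l (ℓ * A) above)))
    (subst₂ _≤_ (cong₂ _*_ (^-*-assoc ℓ ℓ A) (^-*-assoc ℓ (ℓ + 2) A)) (cong₂ _*_ (^-*-assoc (suc ℓ) (ℓ + 2) A) (^-*-assoc l ℓ A))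
      (⊑-^ (ℓ ^ ℓ) (l ^ ℓ) (suc ℓ ^ (ℓ + 2)) (ℓ ^ (ℓ + 2)) A (ratio-above-e l ℓ ℓ≡ 3≤l)))
    where
    lem : ∀ P l A → P * (l * A) ≡ A * (P * l)
    lem = solve-∀

∑∑-shift : ∀ {s m} ℓ (a : Fin s → Fin m → ℕ) → ∑ (λ y → ∑ (λ x → ℓ + a y x)) ≡ ℓ * (s * m) + ∑ (λ y → ∑ (a y))
∑∑-shift {s} {m} ℓ a = begin
  ∑ (λ y → ∑ (λ x → ℓ + a y x))                ≡⟨ ∑-cong (λ y → trans (∑-+ (λ _ → ℓ) (a y)) (cong (_+ ∑ (a y)) (∑-const m ℓ))) ⟩
  ∑ (λ y → m * ℓ + ∑ (a y))                    ≡⟨ ∑-+ (λ _ → m * ℓ) (λ y → ∑ (a y)) ⟩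
  ∑ {s} (λ _ → m * ℓ) + ∑ (λ y → ∑ (a y))      ≡⟨ cong (_+ ∑ (λ y → ∑ (a y))) (trans (∑-const s (m * ℓ)) (lem s m ℓ)) ⟩
  ℓ * (s * m) + ∑ (λ y → ∑ (a y)) ∎
  where
  open ≡-Reasoning
  lem : ∀ s m ℓ → s * (m * ℓ) ≡ ℓ * (s * m)
  lem = solve-∀

-- The expected count times `s * m`, when each vertex draws a pair from `Fin s` and `Fin m`
-- uniformly.
total : ∀ {n s m} → (Fin n → Fin s → Fin m → Bool) → ℕ
total t = ∑ (λ u → ∑ (λ y → ∑ (λ x → [ t u y x ])))

module _ {n N s m : ℕ} (l ℓ : ℕ) (ℓ≡ : ℓ ≡ suc l) (1≤s : 1 ≤ s) (1≤m : 1 ≤ m)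
  (t : Fin N → Fin n → Fin s → Fin m → Bool) where

  private
    F : Fin N → Fin n → Fin s → Fin m → ℕ
    F i u y x = ℓ + [ t i u y x ]
    R : Fin N → ℕ
    R i = ∏ (λ u → ∑ (λ y → ∑ (F i u y)))
    -- These weights make all the products w i * R i equal, so that no constraint dominates the union bound.
    w : Fin N → ℕ
    w i = _∣_.quotient (factor∣∏ R i)
    wR : ∀ i → w i * R i ≡ ∏ R
    wR i = sym (_∣_.equality (factor∣∏ R i))
    1≤ℓ : 1 ≤ ℓ
    1≤ℓ = ≤-trans (s≤s z≤n) (≤-reflexive (sym ℓ≡))
    sumF : ∀ i u → ∑ (λ y → ∑ (F i u y)) ≡ ℓ * (s * m) + ∑ (λ y → ∑ (λ x → [ t i u y x ]))
    sumF i u = ∑∑-shift ℓ (λ y x → [ t i u y x ])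
    1≤R : ∀ i → 1 ≤ R i
    1≤R i = ∏-positive _ λ u → ≤-trans (≤-trans (*-mono-≤ 1≤ℓ (*-mono-≤ 1≤s 1≤m)) (m≤m+n _ _)) (≤-reflexive (sym (sumF i u)))
    w≢0 : ∀ i → NonZero (w i)
    w≢0 i = >-nonZero (n≢0⇒n>0 λ w≡0 → <⇒≢ (∏-positive R 1≤R) (trans (cong (_* R i) (sym w≡0)) (wR i)))

  -- One term is at most the whole sum, and the weights make that sum `N` times the weighted
  -- expectation of any single constraint. The factor `N` is thus the union bound.
  exponential-moment : ∃₂ λ (y : Fin n → Fin s) (x : Fin n → Fin m) → ∀ i →
    (s * m) ^ n * ∏ (λ u → ℓ + [ t i u (y u) (x u) ]) ≤ N * R i
  exponential-moment with derandomize n 1≤s 1≤m w F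
  ... | y , x , h = y , x , λ i → *-cancelˡ-≤ (w i) {{w≢0 i}} (begin
      w i * ((s * m) ^ n * p i)          ≡⟨ lem (w i) ((s * m) ^ n) (p i) ⟩
      (s * m) ^ n * (w i * p i)          ≤⟨ *-monoʳ-≤ ((s * m) ^ n) (term≤∑ (λ i → w i * p i) i) ⟩
      (s * m) ^ n * ∑ (λ i → w i * p i)  ≤⟨ h ⟩
      ∑ (λ i → w i * R i)                ≡⟨ ∑-cong wR ⟩
      ∑ {N} (λ _ → ∏ R)                  ≡⟨ ∑-const N (∏ R) ⟩
      N * ∏ R                            ≡⟨ cong (N *_) (wR i) ⟨
      N * (w i * R i)                    ≡⟨ lem N (w i) (R i) ⟩
      w i * (N * R i) ∎)
    where
    open ≤-Reasoning
    p : Fin N → ℕ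
    p i = ∏ (λ u → F i u (y u) (x u))
    lem : ∀ a b c → a * (b * c) ≡ b * (a * c)
    lem = solve-∀

  chernoff : ∀ g → 3 ≤ l → N ≤ 2 ^ g → ∃₂ λ (y : Fin n → Fin s) (x : Fin n → Fin m) → ∀ i →
    # (λ u → t i u (y u) (x u)) * (s * m * ℓ) ≤ ℓ * (g * (s * m * ℓ)) + (ℓ + 2) * total (t i)
  chernoff g 3≤l N≤2^g with exponential-moment
  ... | y , x , h = y , x , λ i → tail-exponent l ℓ P N g (Y i) (total (t i)) ℓ≡ 3≤l (*-mono-≤ 1≤s 1≤m) N≤2^g
      (*-cancelˡ-≤ (K ^ n) (begin
        K ^ n * (suc ℓ ^ Y i * K ^ A i)                  ≡⟨ cong (_* (suc ℓ ^ Y i * K ^ A i)) (trans (^-distribʳ-* ℓ P n) (*-comm (ℓ ^ n) (P ^ n))) ⟩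
        P ^ n * ℓ ^ n * (suc ℓ ^ Y i * K ^ A i)          ≡⟨ lem₁ (P ^ n) (ℓ ^ n) _ _ ⟩
        P ^ n * (ℓ ^ n * suc ℓ ^ Y i) * K ^ A i          ≡⟨ cong (λ z → P ^ n * z * K ^ A i) (∏-tilted ℓ (λ u → t i u (y u) (x u))) ⟨
        P ^ n * (p i * ℓ ^ Y i) * K ^ A i                ≡⟨ lem₂ (P ^ n) (p i) (ℓ ^ Y i) (K ^ A i) ⟩
        P ^ n * p i * (ℓ ^ Y i * K ^ A i)                ≤⟨ *-monoˡ-≤ (ℓ ^ Y i * K ^ A i) (h i) ⟩
        N * R i * (ℓ ^ Y i * K ^ A i)                    ≡⟨ lem₃ N (R i) (ℓ ^ Y i) (K ^ A i) ⟩
        N * ℓ ^ Y i * (R i * K ^ A i)                    ≤⟨ *-monoʳ-≤ (N * ℓ ^ Y i) (bern i) ⟩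
        N * ℓ ^ Y i * (K ^ n * suc K ^ A i)              ≡⟨ lem₄ N (ℓ ^ Y i) (K ^ n) (suc K ^ A i) ⟩
        K ^ n * (N * suc K ^ A i * ℓ ^ Y i) ∎))
    where
    open ≤-Reasoning
    P = s * m
    K = ℓ * P
    Y A p : Fin N → ℕ
    Y i = # (λ u → t i u (y u) (x u))
    A i = total (t i)
    p i = ∏ (λ u → F i u (y u) (x u))
    instance
      nz : NonZero (K ^ n)
      nz = m^n≢0 K n {{>-nonZero (*-mono-≤ 1≤ℓ (*-mono-≤ 1≤s 1≤m))}}
    bern : ∀ i → R i * K ^ A i ≤ K ^ n * suc K ^ A i
    bern i = subst (λ z → z * K ^ A i ≤ K ^ n * suc K ^ A i) (Product.sum-cong-≗ (λ u → sym (sumF i u)))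
      (∏-bernoulli K (λ u → ∑ (λ y → ∑ (λ x → [ t i u y x ]))))
    lem₁ : ∀ a b c d → a * b * (c * d) ≡ a * (b * c) * d
    lem₁ = solve-∀
    lem₂ : ∀ a b c d → a * (b * c) * d ≡ a * b * (c * d)
    lem₂ = solve-∀
    lem₃ : ∀ a b c d → a * b * (c * d) ≡ a * c * (b * d)
    lem₃ = solve-∀
    lem₄ : ∀ a b c d → a * b * (c * d) ≡ c * (a * d * b)
    lem₄ = solve-∀

-- Divided by `P * ℓ`, the hypothesis says `Y ≤ ℓ * g + (1 + 2/ℓ) * A / P`. For `ℓ = 4 * κ` both
-- error terms are at most `d / (2 * κ)`: the first by `8 * (κ * κ * g) ≤ d`, the second by
-- `A ≤ P * d`.
deviation : ∀ κ g P Y A d ℓ → ℓ ≡ 4 * κ → 8 * (κ * κ * g) ≤ d → A ≤ P * d →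
  Y * (P * ℓ) ≤ ℓ * (g * (P * ℓ)) + (ℓ + 2) * A → κ * P * Y ≤ κ * A + P * d
deviation κ g P Y A d ℓ refl g≤ A≤ h = *-cancelˡ-≤ 4 (begin
  4 * (κ * P * Y)                                       ≡⟨ lem₁ κ P Y ⟩
  Y * (P * (4 * κ))                                     ≤⟨ h ⟩
  4 * κ * (g * (P * (4 * κ))) + (4 * κ + 2) * A         ≡⟨ lem₂ κ g P A ⟩
  2 * P * (8 * (κ * κ * g)) + 4 * κ * A + 2 * A         ≤⟨ +-mono-≤ (+-monoˡ-≤ (4 * κ * A) (*-monoʳ-≤ (2 * P) g≤)) (*-monoʳ-≤ 2 A≤) ⟩
  2 * P * d + 4 * κ * A + 2 * (P * d)                   ≡⟨ lem₃ κ P d A ⟩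
  4 * (κ * A + P * d) ∎)
  where
  open ≤-Reasoning
  lem₁ : ∀ κ P Y → 4 * (κ * P * Y) ≡ Y * (P * (4 * κ))
  lem₁ = solve-∀
  lem₂ : ∀ κ g P A → 4 * κ * (g * (P * (4 * κ))) + (4 * κ + 2) * A ≡ 2 * P * (8 * (κ * κ * g)) + 4 * κ * A + 2 * A
  lem₂ = solve-∀
  lem₃ : ∀ κ P d A → 2 * P * d + 4 * κ * A + 2 * (P * d) ≡ 4 * (κ * A + P * d)
  lem₃ = solve-∀

abstract
  -- The events at `v` depend on the position of `v`, which is itself drawn. So the bound is
  -- demanded for every possible position `θ`, at the price of a factor `m` in the union bound, and
  -- `θ` is specialised afterwards.
  equidistribution : ∀ {c n s m} κ g d₀ → 1 ≤ κ → 1 ≤ s → 1 ≤ m → c * (n * m) ≤ 2 ^ g → 8 * (κ * κ * g) ≤ d₀ →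
    (t : Fin c → Fin n → Fin m → Fin n → Fin s → Fin m → Bool) →
    ∃₂ λ (y : Fin n → Fin s) (x : Fin n → Fin m) → ∀ i v θ d → d₀ ≤ d → total (t i v θ) ≤ s * m * d →
      κ * (s * m) * # (λ u → t i v θ u (y u) (x u)) ≤ κ * total (t i v θ) + s * m * d
  equidistribution {c} {n} {s} {m} κ g d₀ 1≤κ 1≤s 1≤m N≤ g≤ t = go (4 * κ) refl
    where
    flat : Fin (c * (n * m)) → Fin n → Fin s → Fin m → Bool
    flat j = let q = remQuot {c} (n * m) j ; r = remQuot {n} m (proj₂ q) in t (proj₁ q) (proj₁ r) (proj₂ r)
    flat-combine : ∀ i v θ → flat (combine i (combine v θ)) ≡ t i v θ
    flat-combine i v θ = trans
      (cong (λ q → t (proj₁ q) (proj₁ (remQuot {n} m (proj₂ q))) (proj₂ (remQuot {n} m (proj₂ q)))) (remQuot-combine {c} {n * m} i (combine v θ)))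
      (cong (λ q → t i (proj₁ q) (proj₂ q)) (remQuot-combine {n} {m} v θ))
    module _ (ℓ : ℕ) (ℓ≡ : ℓ ≡ 4 * κ) where
      4≤ℓ : 4 ≤ ℓ
      4≤ℓ = ≤-trans (*-monoʳ-≤ 4 1≤κ) (≤-reflexive (sym ℓ≡))
      ℓ≡suc : ℓ ≡ suc (pred ℓ)
      ℓ≡suc = sym (suc-pred ℓ {{>-nonZero (≤-trans (s≤s z≤n) 4≤ℓ)}})
      small : (Fin n → Fin s) → (Fin n → Fin m) → (Fin n → Fin s → Fin m → Bool) → Set
      small y x p = # (λ u → p u (y u) (x u)) * (s * m * ℓ) ≤ ℓ * (g * (s * m * ℓ)) + (ℓ + 2) * total p
      flat-small : ∃₂ λ y x → ∀ j → small y x (flat j)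
      flat-small = chernoff (pred ℓ) ℓ ℓ≡suc 1≤s 1≤m flat g (pred-mono-≤ 4≤ℓ) N≤
      go : ∃₂ λ (y : Fin n → Fin s) (x : Fin n → Fin m) → ∀ i v θ d → d₀ ≤ d → total (t i v θ) ≤ s * m * d →
        κ * (s * m) * # (λ u → t i v θ u (y u) (x u)) ≤ κ * total (t i v θ) + s * m * d
      go = let y , x , h = flat-small in y , x , λ i v θ d d₀≤d A≤ →
        deviation κ g (s * m) (# (λ u → t i v θ u (y u) (x u))) (total (t i v θ)) d ℓ ℓ≡ (≤-trans g≤ d₀≤d) A≤
          (subst (small y x) (flat-combine i v θ) (h (combine i (combine v θ))))

-- The sequential weighting of the special vertices

does⇒ : ∀ {a} {P : Set a} (d : Dec P) → does d ≡ true → P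
does⇒ (yes p) _ = p

count-initial : ∀ {m} (p : Fin m → Bool) k α β → (∀ j → p j ≡ true → (k + toℕ j) * α ≤ β) →
  # p ≡ 0 ⊎ (k + # p) * α ≤ β + α
count-initial {zero} p k α β h = inj₁ refl
count-initial {suc m} p k α β h
  with p zero | h zero | count-initial (p ∘ suc) (suc k) α β (λ j e → subst (λ z → z * α ≤ β) (+-suc k (toℕ j)) (h (suc j) e))
... | false | _ | inj₁ e = inj₁ e
... | false | _ | inj₂ le = inj₂ (≤-trans (*-monoˡ-≤ α (n≤1+n (k + # (p ∘ suc)))) le)
... | true | h₀ | inj₁ e = inj₂ (begin
    (k + (1 + # (p ∘ suc))) * α ≡⟨ cong (λ z → (k + (1 + z)) * α) e ⟩
    (k + 1) * α                 ≡⟨ lem k α ⟩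
    (k + 0) * α + α             ≤⟨ +-monoˡ-≤ α (h₀ refl) ⟩
    β + α ∎)
  where
  open ≤-Reasoning
  lem : ∀ k α → (k + 1) * α ≡ (k + 0) * α + α
  lem = solve-∀
... | true | _ | inj₂ le = inj₂ (≤-trans (≤-reflexive (cong (_* α) (+-suc k _))) le)

-- Once the first true index is found, all others lie within `β / α` of it, and `count-initial`
-- counts them. In the applications `α` is a lower bound for the slope of the weight as a function
-- of the position.
count-spread : ∀ {m} (p : Fin m → Bool) α β →
  (∀ i j → p i ≡ true → p j ≡ true → toℕ i ≤ toℕ j → (toℕ j ∸ toℕ i) * α ≤ β) → # p * α ≤ β + α
count-spread {zero} p α β h = z≤n
count-spread {suc m} p α β h with p zero in eq
... | false = count-spread (p ∘ suc) α β (λ i j pi pj le → h (suc i) (suc j) pi pj (s≤s le))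
... | true with count-initial (p ∘ suc) 1 α β (λ j e → h zero (suc j) eq e z≤n)
...   | inj₁ e = ≤-trans (≤-reflexive (trans (cong (λ z → (1 + z) * α) e) (*-identityˡ α))) (m≤n+m α β)
...   | inj₂ le = le

count-unique : ∀ {m} (p : Fin m → Bool) → (∀ i j → p i ≡ true → p j ≡ true → i ≡ j) → # p ≤ 1
count-unique p h = subst (_≤ 1) (*-identityʳ (# p))
  (count-spread p 1 0 λ i j pi pj _ → ≤-reflexive (cong (_* 1) (trans (cong (λ z → toℕ j ∸ toℕ z) (h i j pi pj)) (n∸n≡0 (toℕ j)))))

select : ∀ {n} (b : Fin n → Bool) k → k ≤ # b → ∃ λ (a : Fin n → Bool) → ∑ (λ u → if b u then [ a u ] else 0) ≡ k
select {zero} b zero _ = (λ ()) , refl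
select {suc n} b k k≤ with b zero
... | false with select (b ∘ suc) k k≤
...   | a , e = false ∷ a , e
select {suc n} b zero k≤ | true with select (b ∘ suc) zero z≤n
...   | a , e = false ∷ a , e
select {suc n} b (suc k) (s≤s k≤) | true with select (b ∘ suc) k k≤
...   | a , e = true ∷ a , cong suc e

weight : ∀ {n} → Graph n → (Fin n → Fin n → ℕ) → Fin n → ℕ
weight G f v = ∑ (λ u → if adj G v u then f v u else 0)

-- Each near vertex rules out at most one `j` per inequation. So fewer than `K` clashes fall on `K`
-- candidates, and a candidate with at most the average number of clashes has none.
avoid : ∀ {n} K L q₀ (near : Fin n → Bool) (q : Fin n → ℕ) → 3 * # near < K →
  ∃ λ j → j < K × (∀ u → near u ≡ true → (q₀ + j ≢ q u) × (q₀ + j ≢ q u + L) × (q₀ + j + L ≢ q u))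
avoid {n} K L q₀ near q few = toℕ j , toℕ<n j , λ u nu → clash u nu
  where
  e₁ e₂ e₃ : Fin K → Fin n → Bool
  e₁ j u = does (q₀ + toℕ j ℕ.≟ q u)
  e₂ j u = does (q₀ + toℕ j ℕ.≟ q u + L)
  e₃ j u = does (q₀ + toℕ j + L ℕ.≟ q u)
  clashes : Fin K → Fin n → ℕ
  clashes j u = if near u then [ e₁ j u ] + [ e₂ j u ] + [ e₃ j u ] else 0
  per-vertex : ∀ u → ∑ (λ j → clashes j u) ≤ 3 * [ near u ]
  per-vertex u with near u
  ... | false = ≤-reflexive (trans (∑-const K 0) (*-zeroʳ K))
  ... | true = ≤-trans (≤-reflexive (trans (∑-+ (λ j → [ e₁ j u ] + [ e₂ j u ]) (λ j → [ e₃ j u ]))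
                 (cong (_+ # (λ j → e₃ j u)) (∑-+ (λ j → [ e₁ j u ]) (λ j → [ e₂ j u ])))))
    (+-mono-≤ (+-mono-≤ (count-unique (λ j → e₁ j u) λ i j p p′ → toℕ-injective (+-cancelˡ-≡ q₀ _ _ (trans (does⇒ (_ ℕ.≟ _) p) (sym (does⇒ (_ ℕ.≟ _) p′)))))
                        (count-unique (λ j → e₂ j u) λ i j p p′ → toℕ-injective (+-cancelˡ-≡ q₀ _ _ (trans (does⇒ (_ ℕ.≟ _) p) (sym (does⇒ (_ ℕ.≟ _) p′))))))
              (count-unique (λ j → e₃ j u) λ i j p p′ → toℕ-injective (+-cancelˡ-≡ q₀ _ _ (+-cancelʳ-≡ L _ _ (trans (does⇒ (_ ℕ.≟ _) p) (sym (does⇒ (_ ℕ.≟ _) p′)))))))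
  average : ∃ λ j → K * ∑ (clashes j) ≤ ∑ (λ j → ∑ (clashes j))
  average = some-below-average K (≤-trans (s≤s z≤n) few) (λ j → ∑ (clashes j))
  j = proj₁ average
  none : ∑ (clashes j) ≡ 0
  none = n≤0⇒n≡0 (≤-pred (*-cancelˡ-< K _ 1 (begin-strict
    K * ∑ (clashes j)                  ≤⟨ proj₂ average ⟩
    ∑ (λ j → ∑ (clashes j))            ≡⟨ Sum.∑-comm clashes ⟩
    ∑ (λ u → ∑ (λ j → clashes j u))    ≤⟨ ∑-mono per-vertex ⟩
    ∑ (λ u → 3 * [ near u ])           ≡⟨ ∑-*ˡ 3 (λ u → [ near u ]) ⟩
    3 * # near                         <⟨ few ⟩
    K                                  ≡⟨ *-identityʳ K ⟨
    K * 1 ∎)))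
    where
    open ≤-Reasoning
  clash : ∀ u → near u ≡ true → (q₀ + toℕ j ≢ q u) × (q₀ + toℕ j ≢ q u + L) × (q₀ + toℕ j + L ≢ q u)
  clash u nu = (λ e → absurd (≤-trans (≤-reflexive (sym (cong [_] (dec-true (_ ℕ.≟ _) e)))) (≤-trans (m≤m+n [ e₁ j u ] [ e₂ j u ]) (m≤m+n _ [ e₃ j u ]))))
             , (λ e → absurd (≤-trans (≤-reflexive (sym (cong [_] (dec-true (_ ℕ.≟ _) e)))) (≤-trans (m≤n+m [ e₂ j u ] [ e₁ j u ]) (m≤m+n _ [ e₃ j u ]))))
             , (λ e → absurd (≤-trans (≤-reflexive (sym (cong [_] (dec-true (_ ℕ.≟ _) e)))) (m≤n+m [ e₃ j u ] _)))
    where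
    zero-term : [ e₁ j u ] + [ e₂ j u ] + [ e₃ j u ] ≡ 0
    zero-term = n≤0⇒n≡0 (≤-trans (≤-reflexive (cong (λ b → if b then [ e₁ j u ] + [ e₂ j u ] + [ e₃ j u ] else 0) (sym nu)))
      (≤-trans (term≤∑ (clashes j) u) (≤-reflexive none)))
    absurd : 1 ≤ [ e₁ j u ] + [ e₂ j u ] + [ e₃ j u ] → ⊥
    absurd le = <⇒≢ le (sym zero-term)

round-up : ∀ c M .{{_ : NonZero M}} → ∃₂ λ q r → c + r ≡ q * M × r < M
round-up c M@(suc M-1) = q , M-1 ∸ ρ , eq , s≤s (m∸n≤m M-1 ρ)
  where
  q = (c + M-1) / M
  ρ = (c + M-1) % M
  ρ≤ : ρ ≤ M-1
  ρ≤ = ≤-pred (m%n<n (c + M-1) M)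
  eq : c + (M-1 ∸ ρ) ≡ q * M
  eq = +-cancelʳ-≡ ρ _ _ (trans (+-assoc c _ ρ) (trans (cong (c +_) (m∸n+n≡m ρ≤)) (trans (m≡m%n+[m/n]*n (c + M-1) M) (+-comm ρ (q * M)))))

-- Two-digit expansions in base T = L M: the lower digit adjusts the residue modulo M, the upper one the range.
reach : ∀ {n} L M T N c (near : Fin n → Bool) (q : Fin n → ℕ) .{{_ : NonZero M}} .{{_ : NonZero T}} → L * M ≡ T → T ≤ N → 3 * # near < L * suc N →
  ∃ λ q′ → (∃₂ λ a a′ → a ≤ N × a′ ≤ N × c + (a + a′ * T) ≡ q′ * M) ×
    (∀ u → near u ≡ true → (q′ ≢ q u) × (q′ ≢ q u + L) × (q′ + L ≢ q u))
reach L M T N c near q LM≡T T≤N few =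
  let q₀ , r , c+r≡ , r<M = round-up c M
      j , j<K , ok = avoid (L * suc N) L q₀ near q few
      -- Since `L * suc N * M = suc N * T`, the `L * suc N` multiples of `M` from `q₀ * M` on are
      -- exactly as many as keep the upper digit `z / T` at most `N`.
      z = r + j * M
      z< : z < suc N * T
      z< = begin-strict
        r + j * M           <⟨ +-monoˡ-< (j * M) r<M ⟩
        suc j * M           ≤⟨ *-monoˡ-≤ M j<K ⟩
        L * suc N * M       ≡⟨ lem L (suc N) M ⟩
        suc N * (L * M)     ≡⟨ cong (suc N *_) LM≡T ⟩
        suc N * T ∎
  in q₀ + j , (z % T , z / T , ≤-trans (<⇒≤ (m%n<n z T)) T≤N , ≤-pred (m<n*o⇒m/o<n {z} {suc N} {T} z<) , (begin-equality
       c + (z % T + z / T * T)   ≡⟨ cong (c +_) (m≡m%n+[m/n]*n z T) ⟨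
       c + (r + j * M)           ≡⟨ +-assoc c r _ ⟨
       c + r + j * M             ≡⟨ cong (_+ j * M) c+r≡ ⟩
       q₀ * M + j * M            ≡⟨ *-distribʳ-+ M q₀ j ⟨
       (q₀ + j) * M ∎)) , ok
  where
  open ≤-Reasoning
  lem : ∀ a b c → a * b * c ≡ b * (a * c)
  lem = solve-∀

[]≤1 : ∀ b → [ b ] ≤ 1
[]≤1 false = z≤n
[]≤1 true = s≤s z≤n

if-+ : ∀ b x y → (if b then x + y else 0) ≡ (if b then x else 0) + (if b then y else 0)
if-+ false x y = refl
if-+ true x y = refl

if-* : ∀ b x c → (if b then x * c else 0) ≡ (if b then x else 0) * c
if-* false x c = refl
if-* true x c = refl

euclid-unique : ∀ M .{{_ : NonZero M}} q q′ r r′ → r < M → r′ < M → q * M + r ≡ q′ * M + r′ → q ≡ q′ × r ≡ r′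
euclid-unique M q q′ r r′ r<M r′<M e = *-cancelʳ-≡ q q′ M (+-cancelʳ-≡ r _ _ (trans e (cong (q′ * M +_) (sym r≡)))) , r≡
  where
  remainder : ∀ q r → r < M → (q * M + r) % M ≡ r
  remainder q r r<M = trans (cong (_% M) (+-comm (q * M) r)) (trans ([m+kn]%n≡m%n r q M) (m<n⇒m%n≡m r<M))
  r≡ : r ≡ r′
  r≡ = trans (sym (remainder q r r<M)) (trans (cong (_% M) e) (remainder q′ r′ r′<M))

-- Here `p` is the part of the weights coming from outside `H`. `dense` lets the lower digit take
-- all values below `T`, and `sparse` leaves a free quotient among the reachable ones.
module Sequential {n} (H : Graph n) (M L T : ℕ) .{{_ : NonZero M}} .{{_ : NonZero T}} (LM≡T : L * M ≡ T)
  (p : Fin n → ℕ) (near : Fin n → Fin n → Bool) (active : Fin n → Bool)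
  (dense : ∀ v → active v ≡ true → T ≤ # (adj H v))
  (sparse : ∀ v → active v ≡ true → 3 * # (near v) < L * suc (# (adj H v))) where

  Digits : ℕ → Set
  Digits b = ∃₂ λ β γ → b ≡ [ β ] + [ γ ] * T

  digits≤ : ∀ {b} → Digits b → b ≤ suc T
  digits≤ (β , γ , refl) = +-mono-≤ ([]≤1 β) (≤-trans (*-monoˡ-≤ T ([]≤1 γ)) (≤-reflexive (*-identityˡ T)))

  done : ℕ → Fin n → ℕ
  done t u = [ does (toℕ u ℕ.<? t) ]

  done-mono : ∀ t u → done t u ≤ done (suc t) u
  done-mono t u = lem (toℕ u ℕ.<? t)
    where
    lem : (d : Dec (toℕ u < t)) → [ does d ] ≤ done (suc t) u
    lem (no _) = z≤n
    lem (yes u<t) = ≤-reflexive (sym (cong [_] (dec-true (toℕ u ℕ.<? suc t) (m≤n⇒m≤1+n u<t))))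

  -- B v is the part of the weight of a processed vertex v that the edges to later vertices can still move within
  -- {0, 1, T, T + 1}; the rest, q v * M, is final.
  record Stage (t : ℕ) : Set where
    field
      h : Fin n → Fin n → ℕ
      B q : Fin n → ℕ
      symmetric : ∀ u v → h u v ≡ h v u
      digits : ∀ v → Digits (B v)
      fresh : ∀ v → t ≤ toℕ v → B v ≡ 0
      -- Reserves enough on each edge with an unprocessed end: the movable part of the other end, at
      -- most `suc T`, can be subtracted from it.
      lower : ∀ u v → t ≤ toℕ u → suc T ≤ h u v
      -- An edge starts at `suc T` and rises by at most `suc T` at the processing of each of its
      -- ends.
      upper : ∀ u v → h u v ≤ suc (done t u + done t v) * suc T
      balanced : ∀ v → toℕ v < t → active v ≡ true → p v + weight H h v ≡ q v * M + B v
      -- As `T = L * M`, setting the upper digit of `B` adds `L` to a quotient. The three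
      -- inequations cover all four combinations at two vertices.
      separated : ∀ u v → toℕ u < toℕ v → toℕ v < t → active v ≡ true → near v u ≡ true →
        (q v ≢ q u) × (q v ≢ q u + L) × (q v + L ≢ q u)

  start : Stage 0
  start = record
    { h = λ _ _ → suc T ; B = λ _ → 0 ; q = λ _ → 0
    ; symmetric = λ _ _ → refl ; digits = λ _ → false , false , refl ; fresh = λ _ _ → refl
    ; lower = λ _ _ _ → ≤-refl ; upper = λ u v → m≤m+n (suc T) _
    ; balanced = λ _ () ; separated = λ _ _ _ () }

  module _ (t : ℕ) (S : Stage t) (τ : Fin n) (τ≡t : toℕ τ ≡ t) where
    open Stage S

    earlier : ∀ v → v ≢ τ → toℕ v < suc t → toℕ v < t
    earlier v v≢τ v<1+t = ≤∧≢⇒< (≤-pred v<1+t) (λ e → v≢τ (toℕ-injective (trans e (sym τ≡t))))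

    skip : active τ ≡ false → Stage (suc t)
    skip inactive = record
      { h = h ; B = B ; q = q ; symmetric = symmetric ; digits = digits
      ; fresh = λ v le → fresh v (<⇒≤ le)
      ; lower = λ u v le → lower u v (<⇒≤ le)
      ; upper = λ u v → ≤-trans (upper u v) (*-monoˡ-≤ (suc T) (s≤s (+-mono-≤ (done-mono t u) (done-mono t v))))
      ; balanced = λ v lt act → balanced v (earlier v (not-τ act) lt) act
      ; separated = λ u v u<v lt act → separated u v u<v (earlier v (not-τ act) lt) act }
      where
      not-τ : ∀ {v} → active v ≡ true → v ≢ τ
      not-τ act refl with trans (sym act) inactive
      ... | ()

    module _ (act : active τ ≡ true) where
      private
        N = # (adj H τ)
        -- The weight of `τ` after the movable parts of all its neighbours have been withdrawn from
        -- the edges at `τ`; every neighbour then receives a new pair of digits.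
        base = p τ + ∑ (λ u → if adj H τ u then h τ u ∸ B u else 0)
        reached = reach L M T N base (near τ) q LM≡T (dense τ act) (sparse τ act)
        q′ = proj₁ reached
        a₀ = proj₁ (proj₁ (proj₂ reached))
        a₁ = proj₁ (proj₂ (proj₁ (proj₂ reached)))
        reached-bounds = proj₂ (proj₂ (proj₁ (proj₂ reached)))
        low = select (adj H τ) a₀ (proj₁ reached-bounds)
        high = select (adj H τ) a₁ (proj₁ (proj₂ reached-bounds))

        A new : Fin n → ℕ
        A u = [ proj₁ low u ] + [ proj₁ high u ] * T
        new u = h τ u ∸ B u + A u

        A-digits : ∀ u → Digits (A u)
        A-digits u = proj₁ low u , proj₁ high u , refl

        sum-A : ∑ (λ u → if adj H τ u then A u else 0) ≡ a₀ + a₁ * T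
        sum-A = begin
          ∑ (λ u → if adj H τ u then A u else 0)
            ≡⟨ ∑-cong (λ u → trans (if-+ (adj H τ u) _ _) (cong (low-term u +_) (if-* (adj H τ u) [ proj₁ high u ] T))) ⟩
          ∑ (λ u → low-term u + high-term u * T)
            ≡⟨ ∑-+ low-term (λ u → high-term u * T) ⟩
          ∑ low-term + ∑ (λ u → high-term u * T)
            ≡⟨ cong₂ _+_ (proj₂ low) (trans (∑-*ʳ T high-term) (cong (_* T) (proj₂ high))) ⟩
          a₀ + a₁ * T ∎
          where
          open ≡-Reasoning
          low-term high-term : Fin n → ℕ
          low-term u = if adj H τ u then [ proj₁ low u ] else 0
          high-term u = if adj H τ u then [ proj₁ high u ] else 0

        h′ : Fin n → Fin n → ℕ
        h′ u v = if does (u ≟ᶠ τ) then new v else if does (v ≟ᶠ τ) then new u else h u v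

        row : ∀ v → h′ τ v ≡ new v
        row v = cong (λ b → if b then new v else if does (v ≟ᶠ τ) then new τ else h τ v) (dec-true (τ ≟ᶠ τ) refl)

        col : ∀ u → h′ u τ ≡ new u
        col u with u ≟ᶠ τ
        ... | yes refl = refl
        ... | no _ = cong (λ b → if b then new u else h u τ) (dec-true (τ ≟ᶠ τ) refl)

        off : ∀ u v → u ≢ τ → v ≢ τ → h′ u v ≡ h u v
        off u v u≢ v≢ = trans (cong (λ b → if b then new v else if does (v ≟ᶠ τ) then new u else h u v) (dec-false (u ≟ᶠ τ) u≢))
          (cong (λ b → if b then new u else h u v) (dec-false (v ≟ᶠ τ) v≢))

        q⁺ B⁺ : Fin n → ℕ
        q⁺ v = if does (v ≟ᶠ τ) then q′ else q v
        -- Only processed neighbours get a new movable part. At later ones the change of the edge is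
        -- ordinary weight, since nothing is balanced there yet.
        B⁺ v = if adj H τ v ∧ does (toℕ v ℕ.<? t) then A v else B v

        q⁺-τ : q⁺ τ ≡ q′
        q⁺-τ = cong (λ b → if b then q′ else q τ) (dec-true (τ ≟ᶠ τ) refl)

        q⁺-off : ∀ v → v ≢ τ → q⁺ v ≡ q v
        q⁺-off v v≢ = cong (λ b → if b then q′ else q v) (dec-false (v ≟ᶠ τ) v≢)

        t≤τ : t ≤ toℕ τ
        t≤τ = ≤-reflexive (sym τ≡t)

        symmetric′ : ∀ u v → h′ u v ≡ h′ v u
        symmetric′ u v = go (u ≟ᶠ τ) (v ≟ᶠ τ)
          where
          go : Dec (u ≡ τ) → Dec (v ≡ τ) → h′ u v ≡ h′ v u
          go (yes refl) _ = trans (row v) (sym (col v))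
          go (no _) (yes refl) = trans (col u) (sym (row u))
          go (no u≢) (no v≢) = trans (off u v u≢ v≢) (trans (symmetric u v) (sym (off v u v≢ u≢)))

        digits′ : ∀ v → Digits (B⁺ v)
        digits′ v with adj H τ v ∧ does (toℕ v ℕ.<? t)
        ... | true = A-digits v
        ... | false = digits v

        B⁺-late : ∀ v → t ≤ toℕ v → B⁺ v ≡ 0
        B⁺-late v le = trans (cong (λ b → if b then A v else B v) (trans (cong (adj H τ v ∧_) (dec-false (toℕ v ℕ.<? t) (≤⇒≯ le))) (∧-zeroʳ _))) (fresh v le)

        lower′ : ∀ u v → suc t ≤ toℕ u → suc T ≤ h′ u v
        lower′ u v lt = go (v ≟ᶠ τ)
          where
          u≢ : u ≢ τ
          u≢ refl = <⇒≢ lt (sym τ≡t)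
          go : Dec (v ≡ τ) → suc T ≤ h′ u v
          go (no v≢) = ≤-trans (lower u v (<⇒≤ lt)) (≤-reflexive (sym (off u v u≢ v≢)))
          go (yes refl) = begin
            suc T                ≤⟨ lower τ u t≤τ ⟩
            h τ u                ≡⟨ cong (h τ u ∸_) (fresh u (<⇒≤ lt)) ⟨
            h τ u ∸ B u          ≤⟨ m≤m+n _ (A u) ⟩
            new u                ≡⟨ col u ⟨
            h′ u τ ∎
            where open ≤-Reasoning

        new-upper : ∀ v → new v ≤ suc (done (suc t) τ + done (suc t) v) * suc T
        new-upper v = begin
          new v                                            ≤⟨ +-mono-≤ (≤-trans (m∸n≤m _ (B v)) (upper τ v)) (digits≤ (A-digits v)) ⟩
          suc (done t τ + done t v) * suc T + suc T        ≡⟨ cong (λ z → suc (z + done t v) * suc T + suc T) (cong [_] (dec-false (toℕ τ ℕ.<? t) (≤⇒≯ t≤τ))) ⟩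
          suc (done t v) * suc T + suc T                   ≡⟨ +-comm (suc (done t v) * suc T) (suc T) ⟩
          suc (1 + done t v) * suc T                       ≤⟨ *-monoˡ-≤ (suc T) (s≤s (s≤s (done-mono t v))) ⟩
          suc (1 + done (suc t) v) * suc T                 ≡⟨ cong (λ z → suc (z + done (suc t) v) * suc T) (cong [_] (dec-true (toℕ τ ℕ.<? suc t) (s≤s (≤-reflexive τ≡t)))) ⟨
          suc (done (suc t) τ + done (suc t) v) * suc T ∎
          where open ≤-Reasoning

        upper′ : ∀ u v → h′ u v ≤ suc (done (suc t) u + done (suc t) v) * suc T
        upper′ u v = go (u ≟ᶠ τ) (v ≟ᶠ τ)
          where
          go : Dec (u ≡ τ) → Dec (v ≡ τ) → h′ u v ≤ suc (done (suc t) u + done (suc t) v) * suc T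
          go (yes refl) _ = ≤-trans (≤-reflexive (row v)) (new-upper v)
          go (no _) (yes refl) = ≤-trans (≤-reflexive (col u)) (≤-trans (new-upper u)
            (≤-reflexive (cong (λ z → suc z * suc T) (+-comm (done (suc t) τ) (done (suc t) u)))))
          go (no u≢) (no v≢) = ≤-trans (≤-reflexive (off u v u≢ v≢)) (≤-trans (upper u v)
            (*-monoˡ-≤ (suc T) (s≤s (+-mono-≤ (done-mono t u) (done-mono t v)))))

        balanced-τ : p τ + weight H h′ τ ≡ q⁺ τ * M + B⁺ τ
        balanced-τ = begin
          p τ + weight H h′ τ
            ≡⟨ cong (p τ +_) (∑-cong λ u → trans (cong (λ z → if adj H τ u then z else 0) (row u)) (if-+ (adj H τ u) _ _)) ⟩
          p τ + ∑ (λ u → (if adj H τ u then h τ u ∸ B u else 0) + (if adj H τ u then A u else 0))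
            ≡⟨ cong (p τ +_) (∑-+ _ (λ u → if adj H τ u then A u else 0)) ⟩
          p τ + (∑ (λ u → if adj H τ u then h τ u ∸ B u else 0) + ∑ (λ u → if adj H τ u then A u else 0))
            ≡⟨ +-assoc (p τ) _ _ ⟨
          base + ∑ (λ u → if adj H τ u then A u else 0)
            ≡⟨ cong (base +_) sum-A ⟩
          base + (a₀ + a₁ * T)
            ≡⟨ proj₂ (proj₂ reached-bounds) ⟩
          q′ * M
            ≡⟨ +-identityʳ _ ⟨
          q′ * M + 0
            ≡⟨ cong₂ (λ a b → a * M + b) q⁺-τ (B⁺-late τ t≤τ) ⟨
          q⁺ τ * M + B⁺ τ ∎
          where open ≡-Reasoning

        -- The edge from `v` to `τ` loses `B v` and gains `A v`, so the final part `q v * M` of the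
        -- weight is untouched.
        balanced-off : ∀ v → v ≢ τ → toℕ v < t → active v ≡ true → p v + weight H h′ v ≡ q v * M + B⁺ v
        balanced-off v v≢ v<t av = go (adj H v τ) refl
          where
          open ≡-Reasoning
          f g : Fin n → ℕ
          f u = if adj H v u then h v u else 0
          g u = if adj H v u then h′ v u else 0
          changed : f τ + ∑ g ≡ g τ + ∑ f
          changed = ∑-update f g τ λ u u≢ → cong (λ z → if adj H v u then z else 0) (sym (off v u v≢ u≢))
          B⁺-v : ∀ b → adj H v τ ≡ b → B⁺ v ≡ (if b then A v else B v)
          B⁺-v b e = cong (λ b → if b then A v else B v) (trans (cong₂ _∧_ (trans (Graph.sym H τ v) e) (dec-true (toℕ v ℕ.<? t) v<t)) (∧-identityʳ b))
          go : ∀ b → adj H v τ ≡ b → p v + ∑ g ≡ q v * M + B⁺ v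
          go false e = begin
            p v + ∑ g         ≡⟨ cong (p v +_) (+-cancelˡ-≡ 0 _ _ (subst₂ (λ x y → x + ∑ g ≡ y + ∑ f) (zeroed (h v τ)) (zeroed (h′ v τ)) changed)) ⟩
            p v + ∑ f         ≡⟨ balanced v v<t av ⟩
            q v * M + B v     ≡⟨ cong (q v * M +_) (B⁺-v false e) ⟨
            q v * M + B⁺ v ∎
            where
            zeroed : ∀ z → (if adj H v τ then z else 0) ≡ 0
            zeroed z = cong (λ b → if b then z else 0) e
          go true e = +-cancelˡ-≡ (h τ v) _ _ (begin
            h τ v + (p v + ∑ g)                   ≡⟨ lem (h τ v) (p v) (∑ g) ⟩
            p v + (h τ v + ∑ g)                   ≡⟨ cong (p v +_) (subst₂ (λ x y → x + ∑ g ≡ y + ∑ f) (trans (kept (h v τ)) (symmetric v τ)) (trans (kept (h′ v τ)) (col v)) changed) ⟩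
            p v + (h τ v ∸ B v + A v + ∑ f)       ≡⟨ lem′ (p v) (h τ v ∸ B v) (A v) (∑ f) ⟩
            h τ v ∸ B v + A v + (p v + ∑ f)       ≡⟨ cong (h τ v ∸ B v + A v +_) (balanced v v<t av) ⟩
            h τ v ∸ B v + A v + (q v * M + B v)   ≡⟨ lem″ (h τ v ∸ B v) (A v) (q v * M) (B v) ⟩
            h τ v ∸ B v + B v + (q v * M + A v)   ≡⟨ cong₂ (λ x y → x + (q v * M + y)) (m∸n+n≡m (≤-trans (digits≤ (digits v)) (lower τ v t≤τ))) (sym (B⁺-v true e)) ⟩
            h τ v + (q v * M + B⁺ v) ∎)
            where
            kept : ∀ z → (if adj H v τ then z else 0) ≡ z
            kept z = cong (λ b → if b then z else 0) e
            lem : ∀ a b c → a + (b + c) ≡ b + (a + c)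
            lem = solve-∀
            lem′ : ∀ a b c d → a + (b + c + d) ≡ b + c + (a + d)
            lem′ = solve-∀
            lem″ : ∀ a b c d → a + b + (c + d) ≡ a + d + (c + b)
            lem″ = solve-∀

        balanced′ : ∀ v → toℕ v < suc t → active v ≡ true → p v + weight H h′ v ≡ q⁺ v * M + B⁺ v
        balanced′ v lt av = go (v ≟ᶠ τ)
          where
          go : Dec (v ≡ τ) → p v + weight H h′ v ≡ q⁺ v * M + B⁺ v
          go (yes refl) = balanced-τ
          go (no v≢) = trans (balanced-off v v≢ (earlier v v≢ lt) av) (cong (λ z → z * M + B⁺ v) (sym (q⁺-off v v≢)))

        separated′ : ∀ u v → toℕ u < toℕ v → toℕ v < suc t → active v ≡ true → near v u ≡ true →
          (q⁺ v ≢ q⁺ u) × (q⁺ v ≢ q⁺ u + L) × (q⁺ v + L ≢ q⁺ u)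
        separated′ u v u<v lt av nvu = subst (λ z → (q⁺ v ≢ z) × (q⁺ v ≢ z + L) × (q⁺ v + L ≢ z)) (sym (q⁺-off u u≢)) (go (v ≟ᶠ τ))
          where
          u≢ : u ≢ τ
          u≢ refl = <⇒≱ u<v (≤-trans (≤-pred lt) t≤τ)
          go : Dec (v ≡ τ) → (q⁺ v ≢ q u) × (q⁺ v ≢ q u + L) × (q⁺ v + L ≢ q u)
          go (yes refl) = subst (λ z → (z ≢ q u) × (z ≢ q u + L) × (z + L ≢ q u)) (sym q⁺-τ) (proj₂ (proj₂ reached) u nvu)
          go (no v≢) = subst (λ z → (z ≢ q u) × (z ≢ q u + L) × (z + L ≢ q u)) (sym (q⁺-off v v≢)) (separated u v u<v (earlier v v≢ lt) av nvu)

      process : Stage (suc t)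
      process = record
        { h = h′ ; B = B⁺ ; q = q⁺ ; symmetric = symmetric′ ; digits = digits′
        ; fresh = λ v le → B⁺-late v (<⇒≤ le) ; lower = lower′ ; upper = upper′
        ; balanced = balanced′ ; separated = separated′ }

    advance : Stage (suc t)
    advance = go (active τ) refl
      where
      go : ∀ b → active τ ≡ b → Stage (suc t)
      go false e = skip e
      go true e = process e

  run : ∀ t → t ≤ n → Stage t
  run zero _ = start
  run (suc t) t<n = advance t (run t (<⇒≤ t<n)) (fromℕ< t<n) (toℕ-fromℕ< t<n)

  open Stage (run n ≤-refl)

  residue : ∀ v → active v ≡ true → ∃ λ γ → ∃ λ β → p v + weight H h v ≡ (q v + [ γ ] * L) * M + [ β ]
  residue v av with digits v
  ... | β , γ , e = γ , β , (begin
      p v + weight H h v               ≡⟨ balanced v (toℕ<n v) av ⟩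
      q v * M + B v                    ≡⟨ cong (q v * M +_) e ⟩
      q v * M + ([ β ] + [ γ ] * T)    ≡⟨ cong (λ z → q v * M + ([ β ] + [ γ ] * z)) LM≡T ⟨
      q v * M + ([ β ] + [ γ ] * (L * M)) ≡⟨ lem (q v) M [ β ] [ γ ] L ⟩
      (q v + [ γ ] * L) * M + [ β ] ∎)
    where
    open ≡-Reasoning
    lem : ∀ q M b g L → q * M + (b + g * (L * M)) ≡ (q + g * L) * M + b
    lem = solve-∀

  distinct : 2 ≤ M → ∀ u v → toℕ u < toℕ v → active u ≡ true → active v ≡ true → near v u ≡ true →
    p u + weight H h u ≢ p v + weight H h v
  distinct 2≤M u v u<v au av nvu e =
    let γ , β , eu = residue u au
        γ′ , β′ , ev = residue v av
    in go γ γ′ (proj₁ (euclid-unique M (q u + [ γ ] * L) (q v + [ γ′ ] * L) [ β ] [ β′ ] (≤-trans (s≤s ([]≤1 β)) 2≤M) (≤-trans (s≤s ([]≤1 β′)) 2≤M) (trans (sym eu) (trans e ev))))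
    where
    sep = separated u v u<v (toℕ<n v) av nvu
    go : ∀ γ γ′ → q u + [ γ ] * L ≡ q v + [ γ′ ] * L → ⊥
    go false false e = proj₁ sep (sym (+-cancelʳ-≡ 0 _ _ e))
    go true true e = proj₁ sep (sym (+-cancelʳ-≡ (1 * L) _ _ e))
    go true false e = proj₁ (proj₂ sep) (trans (sym (+-identityʳ _)) (trans (sym e) (cong (q u +_) (*-identityˡ L))))
    go false true e = proj₂ (proj₂ sep) (trans (cong (q v +_) (sym (*-identityˡ L))) (trans (sym e) (+-identityʳ _)))

  abstract
    sequential-weighting : 2 ≤ M → ∃ λ (h : Fin n → Fin n → ℕ) →
      (∀ u v → h u v ≡ h v u) × (∀ u v → h u v ≤ 3 * suc T) ×
      (∀ v → active v ≡ true → ∃₂ λ r β → p v + weight H h v ≡ r * M + [ β ]) ×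
      (∀ u v → toℕ u < toℕ v → active u ≡ true → active v ≡ true → near v u ≡ true → p u + weight H h u ≢ p v + weight H h v)
    sequential-weighting 2≤M = h , symmetric
      , (λ u v → ≤-trans (upper u v) (*-monoˡ-≤ (suc T) (s≤s (+-mono-≤ ([]≤1 (does (toℕ u ℕ.<? n))) ([]≤1 (does (toℕ v ℕ.<? n)))))))
      , (λ v av → let γ , β , e = residue v av in q v + [ γ ] * L , β , e)
      , distinct 2≤M

-- Positions and special vertices

[]-∧ : ∀ a b → [ a ∧ b ] ≡ [ a ] * [ b ]
[]-∧ false b = refl
[]-∧ true b = sym (+-identityʳ [ b ])

∧-true : ∀ {a b} → a ∧ b ≡ true → a ≡ true × b ≡ true
∧-true {true} {true} _ = refl , refl

count-split : ∀ {n} (a b : Fin n → Bool) → # (λ u → a u ∧ b u) + # (λ u → a u ∧ not (b u)) ≡ # a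
count-split a b = trans (sym (∑-+ (λ u → [ a u ∧ b u ]) (λ u → [ a u ∧ not (b u) ]))) (∑-cong λ u → lem (a u) (b u))
  where
  lem : ∀ a b → [ a ∧ b ] + [ a ∧ not b ] ≡ [ a ]
  lem false b = refl
  lem true false = refl
  lem true true = refl

count-not : ∀ {n} (b : Fin n → Bool) → # b + # (λ u → not (b u)) ≡ n
count-not {n} b = trans (count-split (λ _ → true) b) (trans (∑-const n 1) (*-identityʳ n))

isZero : ∀ {s} → Fin s → Bool
isZero zero = true
isZero (suc _) = false

count-isZero : ∀ s → 1 ≤ s → # {s} isZero ≡ 1
count-isZero (suc s) _ = cong suc (trans (∑-const s 0) (*-zeroʳ s))

count-≥ : ∀ m c → # {m} (λ x → does (c ℕ.≤? toℕ x)) ≡ m ∸ c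
count-≥ zero c = sym (0∸n≡0 c)
count-≥ (suc m) zero = cong suc (trans (∑-const m 1) (*-identityʳ m))
count-≥ (suc m) (suc c) = trans (∑-cong {m} (λ x → cong [_] (shift (c ℕ.≤? toℕ x)))) (count-≥ m c)
  where
  shift : ∀ {x} → (d : Dec (c ≤ x)) → does (suc c ℕ.≤? suc x) ≡ does d
  shift {x} (yes c≤x) = dec-true (suc c ℕ.≤? suc x) (s≤s c≤x)
  shift {x} (no c≰x) = dec-false (suc c ℕ.≤? suc x) (λ le → c≰x (≤-pred le))

-- For a vertex at position `θ` this makes the expected number of heavy edges exactly `d v * θ / n`,
-- so that the planned weight grows linearly with the position.
count-threshold : ∀ m θ → θ ≤ m → # {m} (λ x → does (m ℕ.≤? toℕ x + θ)) ≡ θ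
count-threshold m θ θ≤m = trans (∑-cong {m} λ x → cong [_] (shift (m ∸ θ ℕ.≤? toℕ x))) (trans (count-≥ m (m ∸ θ)) (m∸[m∸n]≡n θ≤m))
  where
  shift : ∀ {x} → (d : Dec (m ∸ θ ≤ x)) → does (m ℕ.≤? x + θ) ≡ does d
  shift {x} (yes le) = dec-true (m ℕ.≤? x + θ) (m∸n≤o⇒m≤o+n m θ le)
    where
    m∸n≤o⇒m≤o+n : ∀ m n {o} → m ∸ n ≤ o → m ≤ o + n
    m∸n≤o⇒m≤o+n m n {o} h = ≤-trans (m≤n+m∸n m n) (≤-trans (+-monoʳ-≤ n h) (≤-reflexive (+-comm n o)))
  shift {x} (no nle) = dec-false (m ℕ.≤? x + θ) (λ le → nle (≤-trans (∸-monoˡ-≤ θ le) (≤-reflexive (m+n∸n≡m x θ))))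

total-∧ : ∀ {n s m} (a : Fin n → Bool) (b : Fin s → Fin m → Bool) →
  total (λ u y x → a u ∧ b y x) ≡ # a * ∑ (λ y → # (b y))
total-∧ a b = trans (∑-cong λ u → trans (∑-cong λ y → trans (∑-cong λ x → []-∧ (a u) (b y x)) (∑-*ˡ [ a u ] (λ x → [ b y x ])))
                     (∑-*ˡ [ a u ] (λ y → # (b y))))
              (∑-*ʳ (∑ (λ y → # (b y))) (λ u → [ a u ]))

∑-first : ∀ {s} m (b : Fin s → Bool) → ∑ (λ y → # {m} (λ _ → b y)) ≡ # b * m
∑-first m b = trans (∑-cong λ y → trans (∑-const m [ b y ]) (*-comm m [ b y ])) (∑-*ʳ m (λ y → [ b y ]))

∑-second : ∀ s {m} (b : Fin m → Bool) → ∑ {s} (λ _ → # b) ≡ s * # b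
∑-second s b = ∑-const s (# b)

∑-isZero : ∀ {s m} → 1 ≤ s → (b : Fin m → Bool) → ∑ {s} (λ y → # (λ x → isZero y ∧ b x)) ≡ # b
∑-isZero {suc s} {m} _ b = trans (cong (# b +_) (trans (∑-cong {s} λ _ → trans (∑-const m 0) (*-zeroʳ m)) (trans (∑-const s 0) (*-zeroʳ s)))) (+-identityʳ _)

/-floor : ∀ a m .{{_ : NonZero m}} → a / m * m ≤ a
/-floor a m = ≤-trans (m≤n+m _ (a % m)) (≤-reflexive (sym (m≡m%n+[m/n]*n a m)))

/-ceil : ∀ a m .{{_ : NonZero m}} → a < suc (a / m) * m
/-ceil a m = ≤-trans (s≤s (≤-reflexive (m≡m%n+[m/n]*n a m))) (+-monoˡ-< (a / m * m) (m%n<n a m))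

same-quotient : ∀ a b E .{{_ : NonZero E}} → a / E ≡ b / E → b < a + E
same-quotient a b E e = begin-strict
  b                  <⟨ /-ceil b E ⟩
  suc (b / E) * E    ≡⟨ cong (λ z → suc z * E) e ⟨
  suc (a / E) * E    ≡⟨ +-comm E _ ⟩
  a / E * E + E      ≤⟨ +-monoˡ-≤ E (/-floor a E) ⟩
  a + E ∎
  where open ≤-Reasoning

-- The modulus is `M = 4 + M₄`, and weights are cut into windows of length `E = M * e`. Two residues
-- are kept for special vertices. The other two of the 4 leave `2 * e` spare places per window: one
-- `e` for rounding, one for the deviation `δ / κ ≤ e`. `sparse` keeps the expected occupancy near
-- `M₄ * e`.
module Layout {n : ℕ} (G : Graph n) (δ M₄ e D s κ g : ℕ) .{{_ : NonZero n}} .{{_ : NonZero s}} .{{_ : NonZero e}}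
  (1≤δ : 1 ≤ δ) (1≤D : 1 ≤ D) (min-degree : ∀ v → δ ≤ # (adj G v)) (18≤s : 18 ≤ s) (2s≤κ : 2 * s ≤ κ)
  (E≤δ : (4 + M₄) * e ≤ δ) (δ≤κe : δ ≤ κ * e) (sparse : n * (4 + M₄) ≤ D * M₄ * δ)
  (constraints : 6 * (n * n) ≤ 2 ^ g) (large : 8 * (κ * κ * g) ≤ δ) where

  E = (4 + M₄) * e

  instance
    nzE : NonZero E
    nzE = m*n≢0 (4 + M₄) e

  d : Fin n → ℕ
  d v = # (adj G v)

  -- Special vertices v and u at positions θ and x can only get equal final weights if they are near.
  near : Fin n → ℕ → Fin n → ℕ → Bool
  near v θ u x = does (D * d u * x ℕ.≤? D * d v * θ + 4 * (n * (d u + d v))) ∧ does (D * d v * θ ℕ.≤? D * d u * x + 4 * (n * (d u + d v)))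

  -- An upper estimate for the planned weight of a vertex at position x; the last terms dominate the deviation D d_v / κ.
  nominal : Fin n → ℕ → ℕ
  nominal v x = d v + D * d v * x / n + (d v / (16 * s)) {{m*n≢0 16 s}} + 1

  window : Fin n → ℕ → ℕ
  window v x = nominal v x / E

  private
    1≤s : 1 ≤ s
    1≤s = ≤-trans (s≤s z≤n) 18≤s
    1≤κ : 1 ≤ κ
    1≤κ = ≤-trans (≤-trans 1≤s (m≤n*m s 2)) 2s≤κ
    s≤κ : s ≤ κ
    s≤κ = ≤-trans (m≤n*m s 2) 2s≤κ
    1≤n : 1 ≤ n
    1≤n = >-nonZero⁻¹ n
    instance
      nzκ : NonZero κ
      nzκ = >-nonZero 1≤κ
      nzDδ : NonZero (D * δ)
      nzDδ = >-nonZero (*-mono-≤ 1≤D 1≤δ)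
    1≤d : ∀ v → 1 ≤ d v
    1≤d v = ≤-trans 1≤δ (min-degree v)

    -- Cases 1 and 3, counted from 0, are the complements of 0 and 2 among the neighbours: bounding
    -- them from above yields the lower bounds `specials-lower` and `heavy-lower`.
    constraint : Fin 6 → Fin n → Fin n → Fin n → Fin s → Fin n → Bool
    constraint zero v θ u y x = adj G v u ∧ isZero y
    constraint (suc zero) v θ u y x = adj G v u ∧ not (isZero y)
    constraint (suc (suc zero)) v θ u y x = adj G v u ∧ does (n ℕ.≤? toℕ x + toℕ θ)
    constraint (suc (suc (suc zero))) v θ u y x = adj G v u ∧ not (does (n ℕ.≤? toℕ x + toℕ θ))
    constraint (suc (suc (suc (suc zero)))) v θ u y x = isZero y ∧ near v (toℕ θ) u (toℕ x)
    constraint (suc (suc (suc (suc (suc zero))))) v θ u y x = does (window u (toℕ x) ℕ.≟ window v (toℕ θ))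

    drawn : ∃₂ λ (y : Fin n → Fin s) (x : Fin n → Fin n) → ∀ i v θ d → δ ≤ d → total (constraint i v θ) ≤ s * n * d →
      κ * (s * n) * # (λ u → constraint i v θ u (y u) (x u)) ≤ κ * total (constraint i v θ) + s * n * d
    drawn = equidistribution κ g δ 1≤κ 1≤s 1≤n constraints large constraint

    colour : Fin n → Fin s
    colour = proj₁ drawn
    position : Fin n → Fin n
    position = proj₁ (proj₂ drawn)
    bound = proj₂ (proj₂ drawn)

  special : Fin n → Bool
  special v = isZero (colour v)

  pos : Fin n → ℕ
  pos v = toℕ (position v)

  specials : Fin n → ℕ
  specials v = # (λ u → adj G v u ∧ special u)

  -- The number of edges at v whose planned weight is D + 1.
  heavy : Fin n → ℕ
  heavy v = # (λ u → adj G v u ∧ does (n ℕ.≤? pos u + pos v))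

  -- The mean is `d v / s`, and the deviation `d v / κ` is no larger.
  specials-upper : ∀ v → s * specials v ≤ 2 * d v
  specials-upper v = *-cancelˡ-≤ (κ * n) {{m*n≢0 κ n}} (begin
    κ * n * (s * N)                ≡⟨ lem₁ κ n s N ⟩
    κ * (s * n) * N                ≤⟨ bound zero v (position v) (d v) (min-degree v) (≤-trans (≤-reflexive A≡) (≤-trans (*-monoʳ-≤ (d v) (*-monoˡ-≤ n 1≤s)) (≤-reflexive (*-comm (d v) (s * n))))) ⟩
    κ * A + s * n * d v            ≡⟨ cong (λ z → κ * z + s * n * d v) A≡ ⟩
    κ * (d v * (1 * n)) + s * n * d v ≤⟨ +-monoʳ-≤ (κ * (d v * (1 * n))) (*-monoˡ-≤ (d v) (*-monoˡ-≤ n s≤κ)) ⟩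
    κ * (d v * (1 * n)) + κ * n * d v ≡⟨ lem₂ κ n (d v) ⟩
    κ * n * (2 * d v) ∎)
    where
    open ≤-Reasoning
    N = specials v
    A = total (constraint zero v (position v))
    A≡ : A ≡ d v * (1 * n)
    A≡ = trans (total-∧ {n} {s} {n} (adj G v) (λ y (_ : Fin n) → isZero y)) (cong (d v *_) (trans (∑-first {s} n isZero) (cong (_* n) (count-isZero s 1≤s))))
    lem₁ : ∀ κ n s N → κ * n * (s * N) ≡ κ * (s * n) * N
    lem₁ = solve-∀
    lem₂ : ∀ κ n d → κ * (d * (1 * n)) + κ * n * d ≡ κ * n * (2 * d)
    lem₂ = solve-∀

  -- The neighbours that are not special exceed their mean by at most `d v / κ`, and `2 * s ≤ κ`
  -- makes this at most half of `d v / s`.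
  specials-lower : ∀ v → d v ≤ 2 * (s * specials v)
  specials-lower v = *-cancelˡ-≤ (κ * n) {{m*n≢0 κ n}} (+-cancelʳ-≤ (κ * n * d v + 2 * (κ * (s * n) * N′)) _ _ (begin
    κ * n * d v + (κ * n * d v + 2 * (κ * (s * n) * N′))          ≤⟨ +-monoʳ-≤ (κ * n * d v) (+-monoʳ-≤ (κ * n * d v) (*-monoʳ-≤ 2 bound₁)) ⟩
    κ * n * d v + (κ * n * d v + 2 * (κ * (d v * (c * n)) + s * n * d v)) ≡⟨ lem₁ κ n (d v) c s ⟩
    2 * (κ * (d v * ((1 + c) * n))) + 2 * s * (n * d v)           ≤⟨ +-mono-≤ (≤-reflexive (cong (λ z → 2 * (κ * (d v * (z * n)))) 1+c)) (*-monoˡ-≤ (n * d v) 2s≤κ) ⟩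
    2 * (κ * (d v * (s * n))) + κ * (n * d v)                     ≡⟨ cong (λ z → 2 * (κ * (z * (s * n))) + κ * (n * d v)) (count-split (adj G v) special) ⟨
    2 * (κ * ((N + N′) * (s * n))) + κ * (n * d v)                ≡⟨ lem₂ κ n s N N′ (d v) ⟩
    κ * n * (2 * (s * N)) + (κ * n * d v + 2 * (κ * (s * n) * N′)) ∎))
    where
    open ≤-Reasoning
    N = specials v
    N′ = # (λ u → adj G v u ∧ not (special u))
    c = # {s} (λ y → not (isZero y))
    1+c : 1 + c ≡ s
    1+c = trans (cong (_+ c) (sym (count-isZero s 1≤s))) (count-not {s} isZero)
    A = total (constraint (suc zero) v (position v))
    A≡ : A ≡ d v * (c * n)
    A≡ = trans (total-∧ {n} {s} {n} (adj G v) (λ y (_ : Fin n) → not (isZero y))) (cong (d v *_) (∑-first {s} n (λ y → not (isZero y))))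
    bound₁ : κ * (s * n) * N′ ≤ κ * (d v * (c * n)) + s * n * d v
    bound₁ = subst (λ z → κ * (s * n) * N′ ≤ κ * z + s * n * d v) A≡ (bound (suc zero) v (position v) (d v) (min-degree v)
      (≤-trans (≤-reflexive A≡) (≤-trans (*-monoʳ-≤ (d v) (*-monoˡ-≤ n (≤-trans (m≤n+m c 1) (≤-reflexive 1+c)))) (≤-reflexive (*-comm (d v) (s * n))))))
    lem₁ : ∀ κ n d c s → κ * n * d + (κ * n * d + 2 * (κ * (d * (c * n)) + s * n * d)) ≡ 2 * (κ * (d * ((1 + c) * n))) + 2 * s * (n * d)
    lem₁ = solve-∀
    lem₂ : ∀ κ n s N N′ d → 2 * (κ * ((N + N′) * (s * n))) + κ * (n * d) ≡ κ * n * (2 * (s * N)) + (κ * n * d + 2 * (κ * (s * n) * N′))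
    lem₂ = solve-∀

  heavy-upper : ∀ v → κ * (n * heavy v) ≤ κ * (d v * pos v) + n * d v
  heavy-upper v = *-cancelˡ-≤ s (begin
    s * (κ * (n * heavy v))                ≡⟨ lem₁ s κ n (heavy v) ⟩
    κ * (s * n) * heavy v                  ≤⟨ bound (suc (suc zero)) v (position v) (d v) (min-degree v) (≤-trans (≤-reflexive A≡) (≤-trans (*-monoʳ-≤ (d v) (*-monoʳ-≤ s θ≤n)) (≤-reflexive (*-comm (d v) (s * n))))) ⟩
    κ * A + s * n * d v                    ≡⟨ cong (λ z → κ * z + s * n * d v) A≡ ⟩
    κ * (d v * (s * pos v)) + s * n * d v  ≡⟨ lem₂ s κ n (d v) (pos v) ⟩
    s * (κ * (d v * pos v) + n * d v) ∎)
    where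
    open ≤-Reasoning
    θ≤n : pos v ≤ n
    θ≤n = <⇒≤ (toℕ<n (position v))
    A = total (constraint (suc (suc zero)) v (position v))
    A≡ : A ≡ d v * (s * pos v)
    A≡ = trans (total-∧ {n} {s} {n} (adj G v) (λ (_ : Fin s) (x : Fin n) → does (n ℕ.≤? toℕ x + pos v)))
      (cong (d v *_) (trans (∑-second s {n} (λ x → does (n ℕ.≤? toℕ x + pos v))) (cong (s *_) (count-threshold n (pos v) θ≤n))))
    lem₁ : ∀ s κ n N → s * (κ * (n * N)) ≡ κ * (s * n) * N
    lem₁ = solve-∀
    lem₂ : ∀ s κ n d θ → κ * (d * (s * θ)) + s * n * d ≡ s * (κ * (d * θ) + n * d)
    lem₂ = solve-∀

  heavy-lower : ∀ v → κ * (d v * pos v) ≤ κ * (n * heavy v) + n * d v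
  heavy-lower v = *-cancelˡ-≤ s (+-cancelʳ-≤ (κ * (s * n) * light) _ _ (begin
    s * (κ * (d v * pos v)) + κ * (s * n) * light                        ≤⟨ +-monoʳ-≤ (s * (κ * (d v * pos v))) bound₁ ⟩
    s * (κ * (d v * pos v)) + (κ * (d v * (s * c)) + s * n * d v)        ≡⟨ lem₁ s κ (d v) (pos v) c n ⟩
    κ * (s * (d v * (pos v + c))) + s * n * d v                          ≡⟨ cong₂ (λ a b → κ * (s * (a * b)) + s * n * d v) (sym (count-split (adj G v) (λ u → does (n ℕ.≤? pos u + pos v)))) θ+c ⟩
    κ * (s * ((heavy v + light) * n)) + s * n * d v                      ≡⟨ lem₂ s κ n (heavy v) light (d v) ⟩
    s * (κ * (n * heavy v) + n * d v) + κ * (s * n) * light ∎))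
    where
    open ≤-Reasoning
    θ≤n : pos v ≤ n
    θ≤n = <⇒≤ (toℕ<n (position v))
    light = # (λ u → adj G v u ∧ not (does (n ℕ.≤? pos u + pos v)))
    c = # {n} (λ x → not (does (n ℕ.≤? toℕ x + pos v)))
    θ+c : pos v + c ≡ n
    θ+c = trans (cong (_+ c) (sym (count-threshold n (pos v) θ≤n))) (count-not {n} (λ x → does (n ℕ.≤? toℕ x + pos v)))
    A = total (constraint (suc (suc (suc zero))) v (position v))
    A≡ : A ≡ d v * (s * c)
    A≡ = trans (total-∧ {n} {s} {n} (adj G v) (λ (_ : Fin s) (x : Fin n) → not (does (n ℕ.≤? toℕ x + pos v))))
      (cong (d v *_) (∑-second s {n} (λ x → not (does (n ℕ.≤? toℕ x + pos v)))))
    bound₁ : κ * (s * n) * light ≤ κ * (d v * (s * c)) + s * n * d v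
    bound₁ = subst (λ z → κ * (s * n) * light ≤ κ * z + s * n * d v) A≡ (bound (suc (suc (suc zero))) v (position v) (d v) (min-degree v)
      (≤-trans (≤-reflexive A≡) (≤-trans (*-monoʳ-≤ (d v) (*-monoʳ-≤ s (≤-trans (m≤n+m c (pos v)) (≤-reflexive θ+c)))) (≤-reflexive (*-comm (d v) (s * n))))))
    lem₁ : ∀ s κ d θ c n → s * (κ * (d * θ)) + (κ * (d * (s * c)) + s * n * d) ≡ κ * (s * (d * (θ + c))) + s * n * d
    lem₁ = solve-∀
    lem₂ : ∀ s κ n h l d → κ * (s * ((h + l) * n)) + s * n * d ≡ s * (κ * (n * h) + n * d) + κ * (s * n) * l
    lem₂ = solve-∀

  crowd : Fin n → ℕ
  crowd v = # (λ u → special u ∧ near v (pos v) u (pos u))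

  n≤Dδ : n ≤ D * δ
  n≤Dδ = *-cancelʳ-≤ n (D * δ) (4 + M₄) (≤-trans sparse (≤-trans (≤-reflexive (lem D M₄ δ)) (*-monoʳ-≤ (D * δ) (m≤n+m M₄ 4))))
    where
    lem : ∀ a b c → a * b * c ≡ a * c * b
    lem = solve-∀

  -- The positions at which `u` is near `v` span at most `8 * n * (d u + d v) / (D * d u)`, hence at
  -- most `16 * n * d v / (D * δ)` as both degrees are at least `δ`. Summing over `u` with
  -- `n ≤ D * δ` gives at most 17 `n * d v`, a mean of 17 `d v / s`; the deviation makes it 18, and
  -- `specials-lower` doubles that.
  crowd-upper : ∀ v → crowd v ≤ 36 * specials v
  crowd-upper v = *-cancelˡ-≤ s (≤-trans crowd≤ (≤-trans (*-monoʳ-≤ 18 (specials-lower v)) (≤-reflexive (lem₅ s (specials v)))))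
    where
    open ≤-Reasoning
    θ = pos v
    row : Fin n → ℕ
    row u = # {n} (λ x → near v θ u (toℕ x))
    A = total (constraint (suc (suc (suc (suc zero)))) v (position v))
    gap : ∀ u i j → near v θ u i ≡ true → near v θ u j ≡ true → i ≤ j → (j ∸ i) * (D * δ) ≤ 16 * (n * d v)
    gap u i j ni nj i≤j = *-cancelʳ-≤ _ _ (d u) {{>-nonZero (1≤d u)}} (begin
      k * (D * δ) * d u                      ≡⟨ lem₁ k D δ (d u) ⟩
      δ * (D * d u * k)                      ≤⟨ *-monoʳ-≤ δ (+-cancelˡ-≤ (D * d u * i) _ _ (begin
        D * d u * i + D * d u * k            ≡⟨ *-distribˡ-+ (D * d u) i k ⟨
        D * d u * (i + k)                    ≡⟨ cong (D * d u *_) (m+[n∸m]≡n i≤j) ⟩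
        D * d u * j                          ≤⟨ does⇒ (_ ℕ.≤? _) (proj₁ (∧-true nj)) ⟩
        D * d v * θ + w                      ≤⟨ +-monoˡ-≤ w (does⇒ (D * d v * θ ℕ.≤? D * d u * i + w) (proj₂ (∧-true {does (D * d u * i ℕ.≤? D * d v * θ + w)} ni))) ⟩
        D * d u * i + w + w                  ≡⟨ +-assoc (D * d u * i) w w ⟩
        D * d u * i + (w + w) ∎)) ⟩
      δ * (w + w)                            ≡⟨ lem₂ δ n (d u) (d v) ⟩
      8 * n * (δ * d u + δ * d v)            ≤⟨ *-monoʳ-≤ (8 * n) (+-mono-≤ (*-monoˡ-≤ (d u) (min-degree v)) (*-monoˡ-≤ (d v) (min-degree u))) ⟩
      8 * n * (d v * d u + d u * d v)        ≡⟨ lem₃ n (d u) (d v) ⟩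
      16 * (n * d v) * d u ∎)
      where
      k = j ∸ i
      w = 4 * (n * (d u + d v))
      lem₁ : ∀ k D δ d → k * (D * δ) * d ≡ δ * (D * d * k)
      lem₁ = solve-∀
      lem₂ : ∀ δ n a b → δ * (4 * (n * (a + b)) + 4 * (n * (a + b))) ≡ 8 * n * (δ * a + δ * b)
      lem₂ = solve-∀
      lem₃ : ∀ n a b → 8 * n * (b * a + a * b) ≡ 16 * (n * b) * a
      lem₃ = solve-∀
    row≤ : ∀ u → row u * (D * δ) ≤ 16 * (n * d v) + D * δ
    row≤ u = count-spread {n} (λ x → near v θ u (toℕ x)) (D * δ) (16 * (n * d v)) (λ i j ni nj i≤j → gap u (toℕ i) (toℕ j) ni nj i≤j)
    A≡ : A ≡ ∑ row
    A≡ = ∑-cong (λ u → ∑-isZero {s} {n} 1≤s (λ x → near v θ u (toℕ x)))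
    A≤ : A ≤ 17 * (n * d v)
    A≤ = *-cancelʳ-≤ _ _ (D * δ) (begin
      A * (D * δ)                               ≡⟨ cong (_* (D * δ)) A≡ ⟩
      ∑ row * (D * δ)                           ≡⟨ ∑-*ʳ (D * δ) row ⟨
      ∑ (λ u → row u * (D * δ))                 ≤⟨ ∑-bound row≤ ⟩
      n * (16 * (n * d v) + D * δ)              ≡⟨ *-distribˡ-+ n _ (D * δ) ⟩
      n * (16 * (n * d v)) + n * (D * δ)        ≤⟨ +-mono-≤ (*-monoˡ-≤ (16 * (n * d v)) n≤Dδ) (*-monoˡ-≤ (D * δ) (m≤m*n n (d v) {{>-nonZero (1≤d v)}})) ⟩
      D * δ * (16 * (n * d v)) + n * d v * (D * δ) ≡⟨ lem (D * δ) (n * d v) ⟩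
      17 * (n * d v) * (D * δ) ∎)
      where
      lem : ∀ a b → a * (16 * b) + b * a ≡ 17 * b * a
      lem = solve-∀
    crowd≤ : s * crowd v ≤ 18 * d v
    crowd≤ = *-cancelˡ-≤ (κ * n) {{m*n≢0 κ n}} (begin
      κ * n * (s * crowd v)                  ≡⟨ lem₁ κ n s (crowd v) ⟩
      κ * (s * n) * crowd v                  ≤⟨ bound (suc (suc (suc (suc zero)))) v (position v) (d v) (min-degree v)
                                                  (≤-trans A≤ (≤-trans (*-monoˡ-≤ (n * d v) (≤-trans (n≤1+n 17) 18≤s)) (≤-reflexive (sym (*-assoc s n (d v)))))) ⟩
      κ * A + s * n * d v                    ≤⟨ +-mono-≤ (*-monoʳ-≤ κ A≤) (*-monoˡ-≤ (d v) (*-monoˡ-≤ n s≤κ)) ⟩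
      κ * (17 * (n * d v)) + κ * n * d v     ≡⟨ lem₂ κ n (d v) ⟩
      κ * n * (18 * d v) ∎)
      where
      lem₁ : ∀ κ n s N → κ * n * (s * N) ≡ κ * (s * n) * N
      lem₁ = solve-∀
      lem₂ : ∀ κ n d → κ * (17 * (n * d)) + κ * n * d ≡ κ * n * (18 * d)
      lem₂ = solve-∀
    lem₅ : ∀ s N → 18 * (2 * (s * N)) ≡ s * (36 * N)
    lem₅ = solve-∀

  -- As a function of the position, `nominal` has slope at least `D * δ / n`, so each `u` has at
  -- most `E * n / (D * δ) + 1` positions in the window. By `sparse` the mean is at most
  -- `M₄ * e + 1`; the deviation is at most `δ / κ ≤ e`.
  window-occupancy : ∀ v → # (λ u → does (window u (pos u) ℕ.≟ window v (pos v))) ≤ (2 + M₄) * e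
  window-occupancy v = *-cancelˡ-≤ κ (begin
    κ * Y                                          ≤⟨ κY≤ ⟩
    κ * (M₄ * e + 1) + δ                           ≤⟨ +-monoʳ-≤ _ δ≤κe ⟩
    κ * (M₄ * e + 1) + κ * e                       ≡⟨ *-distribˡ-+ κ (M₄ * e + 1) e ⟨
    κ * (M₄ * e + 1 + e)                           ≤⟨ *-monoʳ-≤ κ (≤-trans (+-monoˡ-≤ e (+-monoʳ-≤ (M₄ * e) (>-nonZero⁻¹ e))) (≤-reflexive (lem₀ M₄ e))) ⟩
    κ * ((2 + M₄) * e) ∎)
    where
    open ≤-Reasoning
    lem₀ : ∀ M e → M * e + e + e ≡ (2 + M) * e
    lem₀ = solve-∀
    target = window v (pos v)
    Y = # (λ u → does (window u (pos u) ℕ.≟ target))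
    row : Fin n → ℕ
    row u = # {n} (λ x → does (window u (toℕ x) ℕ.≟ target))
    A = total (constraint (suc (suc (suc (suc (suc zero))))) v (position v))
    gap : ∀ u i j → window u i ≡ target → window u j ≡ target → i ≤ j → (j ∸ i) * (D * δ) ≤ E * n
    gap u i j wi wj i≤j = begin
      k * (D * δ)                       ≡⟨ lem₁ k D δ ⟩
      D * δ * k                         ≤⟨ *-monoˡ-≤ k (*-monoʳ-≤ D (min-degree u)) ⟩
      D * d u * k                       ≤⟨ +-cancelˡ-≤ (D * d u * i) _ _ (begin
        D * d u * i + D * d u * k       ≡⟨ *-distribˡ-+ (D * d u) i k ⟨
        D * d u * (i + k)               ≡⟨ cong (D * d u *_) (m+[n∸m]≡n i≤j) ⟩
        D * d u * j                     ≤⟨ <⇒≤ (/-ceil (D * d u * j) n) ⟩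
        suc (D * d u * j / n) * n       ≤⟨ *-monoˡ-≤ n (+-cancelˡ-≤ (d u) _ _ (+-cancelʳ-≤ b _ _ (+-cancelʳ-≤ 1 _ _ close))) ⟩
        (D * d u * i / n + E) * n       ≡⟨ *-distribʳ-+ n (D * d u * i / n) E ⟩
        D * d u * i / n * n + E * n     ≤⟨ +-monoˡ-≤ (E * n) (/-floor (D * d u * i) n) ⟩
        D * d u * i + E * n ∎) ⟩
      E * n ∎
      where
      k = j ∸ i
      b = (d u / (16 * s)) {{m*n≢0 16 s}}
      lem₁ : ∀ k D δ → k * (D * δ) ≡ D * δ * k
      lem₁ = solve-∀
      lem₂ : ∀ a x b → a + suc x + b + 1 ≡ suc (a + x + b + 1)
      lem₂ = solve-∀
      lem₃ : ∀ a x b E → a + x + b + 1 + E ≡ a + (x + E) + b + 1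
      lem₃ = solve-∀
      close : d u + suc (D * d u * j / n) + b + 1 ≤ d u + (D * d u * i / n + E) + b + 1
      close = subst₂ _≤_ (sym (lem₂ (d u) (D * d u * j / n) b)) (lem₃ (d u) (D * d u * i / n) b E)
        (same-quotient (nominal u i) (nominal u j) E (trans wi (sym wj)))
    row≤ : ∀ u → row u * (D * δ) ≤ E * n + D * δ
    row≤ u = count-spread {n} (λ x → does (window u (toℕ x) ℕ.≟ target)) (D * δ) (E * n)
      (λ i j wi wj i≤j → gap u (toℕ i) (toℕ j) (does⇒ (_ ℕ.≟ _) wi) (does⇒ (_ ℕ.≟ _) wj) i≤j)
    A≡ : A ≡ s * ∑ row
    A≡ = trans (∑-cong (λ u → ∑-second s {n} (λ x → does (window u (toℕ x) ℕ.≟ target)))) (∑-*ˡ s row)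
    rows≤ : ∑ row ≤ n * (M₄ * e + 1)
    rows≤ = *-cancelʳ-≤ _ _ (D * δ) (begin
      ∑ row * (D * δ)                           ≡⟨ ∑-*ʳ (D * δ) row ⟨
      ∑ (λ u → row u * (D * δ))                 ≤⟨ ∑-bound row≤ ⟩
      n * (E * n + D * δ)                       ≡⟨ lem₁ n (4 + M₄) e (D * δ) ⟩
      n * (4 + M₄) * (e * n) + n * (D * δ)      ≤⟨ +-monoˡ-≤ (n * (D * δ)) (*-monoˡ-≤ (e * n) sparse) ⟩
      D * M₄ * δ * (e * n) + n * (D * δ)        ≡⟨ lem₂ n M₄ e D δ ⟩
      n * (M₄ * e + 1) * (D * δ) ∎)
      where
      lem₁ : ∀ n M e x → n * (M * e * n + x) ≡ n * M * (e * n) + n * x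
      lem₁ = solve-∀
      lem₂ : ∀ n M e D δ → D * M * δ * (e * n) + n * (D * δ) ≡ n * (M * e + 1) * (D * δ)
      lem₂ = solve-∀
    A≤ : A ≤ s * (n * (M₄ * e + 1))
    A≤ = ≤-trans (≤-reflexive A≡) (*-monoʳ-≤ s rows≤)
    M₄e+1≤δ : M₄ * e + 1 ≤ δ
    M₄e+1≤δ = ≤-trans (+-monoʳ-≤ (M₄ * e) (≤-trans (>-nonZero⁻¹ e) (m≤n*m e 4))) (≤-trans (≤-reflexive (lem M₄ e)) E≤δ)
      where
      lem : ∀ M e → M * e + 4 * e ≡ (4 + M) * e
      lem = solve-∀
    κY≤ : κ * Y ≤ κ * (M₄ * e + 1) + δ
    κY≤ = *-cancelˡ-≤ (s * n) {{m*n≢0 s n}} (begin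
      s * n * (κ * Y)                                 ≡⟨ lem₁ s n κ Y ⟩
      κ * (s * n) * Y                                 ≤⟨ bound (suc (suc (suc (suc (suc zero))))) v (position v) δ ≤-refl
                                                           (≤-trans A≤ (≤-trans (≤-reflexive (sym (*-assoc s n _))) (*-monoʳ-≤ (s * n) M₄e+1≤δ))) ⟩
      κ * A + s * n * δ                               ≤⟨ +-monoˡ-≤ (s * n * δ) (*-monoʳ-≤ κ A≤) ⟩
      κ * (s * (n * (M₄ * e + 1))) + s * n * δ        ≡⟨ lem₂ κ s n (M₄ * e + 1) δ ⟩
      s * n * (κ * (M₄ * e + 1) + δ) ∎)
      where
      lem₁ : ∀ s n κ Y → s * n * (κ * Y) ≡ κ * (s * n) * Y
      lem₁ = solve-∀
      lem₂ : ∀ κ s n x δ → κ * (s * (n * x)) + s * n * δ ≡ s * n * (κ * x + δ)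
      lem₂ = solve-∀

-- The weighting for large minimum degree

wdeg-weight : ∀ {n} (G : Graph n) f v → wdeg G f v ≡ weight G f v
wdeg-weight {n} G f v = trans (cong sum (map-tabulate id term)) (sum-tabulate term)
  where
  term : Fin n → ℕ
  term u = if adj G v u then f v u else 0
  sum-tabulate : ∀ {n} (g : Fin n → ℕ) → sum (tabulate g) ≡ ∑ g
  sum-tabulate {zero} g = refl
  sum-tabulate {suc n} g = cong (g zero +_) (sum-tabulate (g ∘ suc))

[]-mono : ∀ {a b} → (a ≡ true → b ≡ true) → [ a ] ≤ [ b ]
[]-mono {false} _ = z≤n
[]-mono {true} h = ≤-reflexive (sym (cong [_] (h refl)))

count-< : ∀ {n} (p q : Fin n → Bool) → (∀ i → p i ≡ true → q i ≡ true) → ∀ j → p j ≡ false → q j ≡ true → # p < # q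
count-< p q p⇒q zero pj qj = +-mono-<-≤ (subst₂ _<_ (sym (cong [_] pj)) (sym (cong [_] qj)) (s≤s z≤n)) (∑-mono (λ i → []-mono (p⇒q (suc i))))
count-< p q p⇒q (suc j) pj qj = +-mono-≤-< ([]-mono (p⇒q zero)) (count-< (p ∘ suc) (q ∘ suc) (λ i → p⇒q (suc i)) j pj qj)

module Assembly {n : ℕ} (G : Graph n) (δ M₄ e D s κ g L T : ℕ)
  .{{_ : NonZero n}} .{{_ : NonZero s}} .{{_ : NonZero e}} .{{_ : NonZero T}}
  (1≤δ : 1 ≤ δ) (1≤D : 1 ≤ D) (min-degree : ∀ v → δ ≤ # (adj G v)) (18≤s : 18 ≤ s) (2s≤κ : 2 * s ≤ κ)
  (E≤δ : (4 + M₄) * e ≤ δ) (δ≤κe : δ ≤ κ * e) (sparse : n * (4 + M₄) ≤ D * M₄ * δ)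
  (constraints : 6 * (n * n) ≤ 2 ^ g) (large : 8 * (κ * κ * g) ≤ δ)
  (LM≡T : L * (4 + M₄) ≡ T) (108≤L : 108 ≤ L) (3T≤D : 3 * suc T ≤ D + 3) (2D≤s : 2 * (D + 3) ≤ s)
  (κ≡ : κ ≡ 16 * (D * s)) (16sE≤δ : 16 * (s * ((4 + M₄) * e)) ≤ δ) (4s≤δ : 4 * s ≤ δ) (2sT≤δ : 2 * (s * T) ≤ δ) where

  open Layout G δ M₄ e D s κ g 1≤δ 1≤D min-degree 18≤s 2s≤κ E≤δ δ≤κe sparse constraints large

  M : ℕ
  M = 4 + M₄

  private
    instance
      nz16s : NonZero (16 * s)
      nz16s = m*n≢0 16 s
      nzD : NonZero D
      nzD = >-nonZero 1≤D

  opaque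
    same-window : Fin n → Fin n → Bool
    same-window u v = does (window u (pos u) ℕ.≟ window v (pos v))

    same-window-refl : ∀ v → same-window v v ≡ true
    same-window-refl v = dec-true (window v (pos v) ℕ.≟ window v (pos v)) refl

    same-window-≡ : ∀ u v → window u (pos u) ≡ window v (pos v) → same-window u v ≡ true
    same-window-≡ u v = dec-true (window u (pos u) ℕ.≟ window v (pos v))

    same-window-trans : ∀ u v w → window v (pos v) ≡ window w (pos w) → same-window u v ≡ true → same-window u w ≡ true
    same-window-trans u v w e h = same-window-≡ u w (trans (does⇒ (window u (pos u) ℕ.≟ window v (pos v)) h) e)

    occupancy : ∀ v → # (λ u → same-window u v) ≤ (2 + M₄) * e
    occupancy = window-occupancy

  before : Fin n → Fin n → Bool
  before v u = does (toℕ u ℕ.<? toℕ v) ∧ same-window u v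

  rank : Fin n → ℕ
  rank v = # (before v)

  not-before : ∀ v → before v v ≡ false
  not-before v = cong (_∧ same-window v v) (dec-false (toℕ v ℕ.<? toℕ v) (<-irrefl refl))

  rank< : ∀ v → rank v < (2 + M₄) * e
  rank< v = ≤-trans (count-< (before v) (λ u → same-window u v) (λ u h → proj₂ (∧-true {does (toℕ u ℕ.<? toℕ v)} h)) v
    (not-before v) (same-window-refl v)) (occupancy v)

  rank-mono : ∀ u v → window u (pos u) ≡ window v (pos v) → toℕ u < toℕ v → rank u < rank v
  rank-mono u v e u<v = count-< (before u) (before v) later u (not-before u)
    (cong₂ _∧_ (dec-true (toℕ u ℕ.<? toℕ v) u<v) (same-window-≡ u v e))
    where
    later : ∀ w → before u w ≡ true → before v w ≡ true
    later w h = let lt , same = ∧-true {does (toℕ w ℕ.<? toℕ u)} h in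
      cong₂ _∧_ (dec-true (toℕ w ℕ.<? toℕ v) (<-trans (does⇒ (toℕ w ℕ.<? toℕ u) lt) u<v)) (same-window-trans w u v e same)

  rank-injective : ∀ u v → window u (pos u) ≡ window v (pos v) → rank u ≡ rank v → u ≡ v
  rank-injective u v e r with <-cmp (toℕ u) (toℕ v)
  ... | tri< lt _ _ = ⊥-elim (<⇒≢ (rank-mono u v e lt) r)
  ... | tri≈ _ eq _ = toℕ-injective eq
  ... | tri> _ _ gt = ⊥-elim (<⇒≢ (rank-mono v u (sym e) gt) (sym r))

  -- A window consists of `e` rows of `M` consecutive integers with `2 + M₄` usable residues each;
  -- ranks fill it row by row.
  row column : Fin n → ℕ
  row v = rank v / (2 + M₄)
  column v = rank v % (2 + M₄)

  row< : ∀ v → row v < e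
  row< v = m<n*o⇒m/o<n {rank v} {e} {2 + M₄} (≤-trans (rank< v) (≤-reflexive (*-comm (2 + M₄) e)))

  column< : ∀ v → 2 + column v < M
  column< v = +-monoʳ-< 2 (m%n<n (rank v) (2 + M₄))

  -- Lies in the window after the one of v, and is neither 0 nor 1 modulo M.
  target : Fin n → ℕ
  target v = (suc (window v (pos v)) * e + row v) * M + (2 + column v)

  target-injective : ∀ u v → target u ≡ target v → u ≡ v
  target-injective u v eq =
    let block , col = euclid-unique M (suc (window u (pos u)) * e + row u) (suc (window v (pos v)) * e + row v) _ _ (column< u) (column< v) eq
        win , row≡ = euclid-unique e (suc (window u (pos u))) (suc (window v (pos v))) (row u) (row v) (row< u) (row< v) block
    in rank-injective u v (suc-injective win) (begin
      rank u                                       ≡⟨ m≡m%n+[m/n]*n (rank u) (2 + M₄) ⟩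
      column u + row u * (2 + M₄)                  ≡⟨ cong₂ (λ c r → c + r * (2 + M₄)) (+-cancelˡ-≡ 2 _ _ col) row≡ ⟩
      column v + row v * (2 + M₄)                  ≡⟨ m≡m%n+[m/n]*n (rank v) (2 + M₄) ⟨
      rank v ∎)
    where open ≡-Reasoning

  target-residue : ∀ v r β → target v ≢ r * M + [ β ]
  target-residue v r β eq = <⇒≱ (s≤s ([]≤1 β)) (≤-trans (m≤m+n 2 (column v)) (≤-reflexive (proj₂
    (euclid-unique M (suc (window v (pos v)) * e + row v) r _ _ (column< v) (≤-trans (s≤s ([]≤1 β)) (s≤s (s≤s z≤n))) eq))))

  -- Corrections only increase a weight, so a target must not lie below the planned weight; this is
  -- why targets are taken from the next window.
  nominal≤target : ∀ v → nominal v (pos v) ≤ target v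
  nominal≤target v = begin
    nominal v (pos v)                           ≤⟨ <⇒≤ (/-ceil (nominal v (pos v)) E) ⟩
    suc (window v (pos v)) * (M * e)            ≡⟨ lem (suc (window v (pos v))) M e ⟩
    suc (window v (pos v)) * e * M              ≤⟨ *-monoˡ-≤ M (m≤m+n (suc (window v (pos v)) * e) (row v)) ⟩
    (suc (window v (pos v)) * e + row v) * M    ≤⟨ m≤m+n _ _ ⟩
    target v ∎
    where
    open ≤-Reasoning
    lem : ∀ a M e → a * (M * e) ≡ a * e * M
    lem = solve-∀

  target≤nominal+2E : ∀ v → target v ≤ nominal v (pos v) + 2 * E
  target≤nominal+2E v = begin
    (suc w * e + row v) * M + (2 + column v)    ≤⟨ +-monoʳ-≤ _ (<⇒≤ (column< v)) ⟩
    (suc w * e + row v) * M + M                 ≡⟨ lem (suc w * e) (row v) M ⟩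
    (suc w * e + suc (row v)) * M               ≤⟨ *-monoˡ-≤ M (+-monoʳ-≤ (suc w * e) (row< v)) ⟩
    (suc w * e + e) * M                         ≡⟨ lem′ w e M ⟩
    w * (M * e) + 2 * (M * e)                   ≤⟨ +-monoˡ-≤ (2 * (M * e)) (/-floor (nominal v (pos v)) E) ⟩
    nominal v (pos v) + 2 * E ∎
    where
    open ≤-Reasoning
    w = window v (pos v)
    lem : ∀ a r M → (a + r) * M + M ≡ (a + suc r) * M
    lem = solve-∀
    lem′ : ∀ w e M → (suc w * e + e) * M ≡ w * (M * e) + 2 * (M * e)
    lem′ = solve-∀

  heavy? : Fin n → Fin n → Bool
  heavy? v u = does (n ℕ.≤? pos u + pos v)

  plan : Fin n → Fin n → ℕ
  plan v u = suc (if heavy? v u then D else 0)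

  plan-sym : ∀ u v → plan u v ≡ plan v u
  plan-sym u v = cong (λ z → suc (if does (n ℕ.≤? z) then D else 0)) (+-comm (pos v) (pos u))

  plan-weight : ∀ v → weight G plan v ≡ d v + D * heavy v
  plan-weight v = trans (∑-cong λ u → lem (adj G v u) (heavy? v u)) (trans (∑-+ (λ u → [ adj G v u ]) (λ u → D * [ adj G v u ∧ heavy? v u ]))
    (cong (d v +_) (∑-*ˡ D (λ u → [ adj G v u ∧ heavy? v u ]))))
    where
    lem : ∀ a b → (if a then suc (if b then D else 0) else 0) ≡ [ a ] + D * [ a ∧ b ]
    lem false b = sym (*-zeroʳ D)
    lem true false = cong suc (sym (*-zeroʳ D))
    lem true true = cong suc (sym (*-identityʳ D))

  private
    a b : Fin n → ℕ
    a v = D * d v * pos v / n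
    b v = d v / (16 * s)

  -- A miscount of `d v / κ` heavy edges amounts to `D * d v / κ = d v / (16 * s)`, the third term
  -- of `nominal`. The two floors lose less than 2 together, hence at most 1 among integers.
  plan≤nominal : ∀ v → d v + D * heavy v ≤ nominal v (pos v)
  plan≤nominal v = ≤-trans (+-monoʳ-≤ (d v) (≤-pred (*-cancelˡ-< (16 * s * n) _ _ (begin-strict
    16 * s * n * (D * heavy v)                                      ≡⟨ lem₁ s n D (heavy v) ⟩
    16 * (D * s) * (n * heavy v)                                    ≤⟨ subst (λ z → z * (n * heavy v) ≤ z * (d v * pos v) + n * d v) κ≡ (heavy-upper v) ⟩
    16 * (D * s) * (d v * pos v) + n * d v                          ≡⟨ lem₂ s D (d v) (pos v) n ⟩
    16 * s * (D * d v * pos v) + n * d v                            <⟨ +-mono-≤-< (*-monoʳ-≤ (16 * s) (<⇒≤ (/-ceil (D * d v * pos v) n))) (*-monoʳ-< n (/-ceil (d v) (16 * s))) ⟩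
    16 * s * (suc (a v) * n) + n * (suc (b v) * (16 * s))           ≡⟨ lem₃ s n (a v) (b v) ⟩
    16 * s * n * suc (a v + b v + 1) ∎)))) (≤-reflexive (lem₄ (d v) (a v) (b v)))
    where
    open ≤-Reasoning
    lem₁ : ∀ s n D Y → 16 * s * n * (D * Y) ≡ 16 * (D * s) * (n * Y)
    lem₁ = solve-∀
    lem₂ : ∀ s D d θ n → 16 * (D * s) * (d * θ) + n * d ≡ 16 * s * (D * d * θ) + n * d
    lem₂ = solve-∀
    lem₃ : ∀ s n a b → 16 * s * (suc a * n) + n * (suc b * (16 * s)) ≡ 16 * s * n * suc (a + b + 1)
    lem₃ = solve-∀
    lem₄ : ∀ d a b → d + (a + b + 1) ≡ d + a + b + 1
    lem₄ = solve-∀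

  -- Everything is measured in units of `d v / (16 * s)`: one for the deviation, one for the third
  -- term of `nominal`, four for the 1 (from `4 * s ≤ δ`) and two for `2 * E`. The eight units make
  -- `d v / (2 * s)`, at most the number of special neighbours.
  nominal+2E≤plan+specials : ∀ v → nominal v (pos v) + 2 * E ≤ d v + D * heavy v + specials v
  nominal+2E≤plan+specials v = *-cancelˡ-≤ (16 * s) (begin
    16 * s * (d v + a v + b v + 1 + 2 * E)
      ≡⟨ lem₁ s (d v) (a v) (b v) E ⟩
    16 * s * d v + 16 * s * a v + b v * (16 * s) + 4 * (4 * s) + 2 * (16 * (s * E))
      ≤⟨ +-mono-≤ (+-mono-≤ (+-mono-≤ (+-monoʳ-≤ (16 * s * d v) floor) (/-floor (d v) (16 * s))) (*-monoʳ-≤ 4 (≤-trans 4s≤δ (min-degree v)))) (*-monoʳ-≤ 2 (≤-trans 16sE≤δ (min-degree v))) ⟩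
    16 * s * d v + (16 * s * (D * heavy v) + d v) + d v + 4 * d v + 2 * d v
      ≡⟨ lem₂ s (d v) (D * heavy v) ⟩
    16 * s * (d v + D * heavy v) + 8 * d v
      ≤⟨ +-monoʳ-≤ (16 * s * (d v + D * heavy v)) (*-monoʳ-≤ 8 (specials-lower v)) ⟩
    16 * s * (d v + D * heavy v) + 8 * (2 * (s * specials v))
      ≡⟨ lem₃ s (d v + D * heavy v) (specials v) ⟩
    16 * s * (d v + D * heavy v + specials v) ∎)
    where
    open ≤-Reasoning
    floor : 16 * s * a v ≤ 16 * s * (D * heavy v) + d v
    floor = *-cancelˡ-≤ n (begin
      n * (16 * s * a v)                        ≡⟨ lem₄ n s (a v) ⟩
      16 * s * (a v * n)                        ≤⟨ *-monoʳ-≤ (16 * s) (/-floor (D * d v * pos v) n) ⟩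
      16 * s * (D * d v * pos v)                ≡⟨ lem₅ s D (d v) (pos v) ⟩
      16 * (D * s) * (d v * pos v)              ≤⟨ subst (λ z → z * (d v * pos v) ≤ z * (n * heavy v) + n * d v) κ≡ (heavy-lower v) ⟩
      16 * (D * s) * (n * heavy v) + n * d v    ≡⟨ lem₆ s D n (heavy v) (d v) ⟩
      n * (16 * s * (D * heavy v) + d v) ∎)
      where
      lem₄ : ∀ n s a → n * (16 * s * a) ≡ 16 * s * (a * n)
      lem₄ = solve-∀
      lem₅ : ∀ s D d θ → 16 * s * (D * d * θ) ≡ 16 * (D * s) * (d * θ)
      lem₅ = solve-∀
      lem₆ : ∀ s D n Y d → 16 * (D * s) * (n * Y) + n * d ≡ n * (16 * s * (D * Y) + d)
      lem₆ = solve-∀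
    lem₁ : ∀ s d a b E → 16 * s * (d + a + b + 1 + 2 * E) ≡ 16 * s * d + 16 * s * a + b * (16 * s) + 4 * (4 * s) + 2 * (16 * (s * E))
    lem₁ = solve-∀
    lem₂ : ∀ s d x → 16 * s * d + (16 * s * x + d) + d + 4 * d + 2 * d ≡ 16 * s * (d + x) + 8 * d
    lem₂ = solve-∀
    lem₃ : ∀ s x N → 16 * s * x + 8 * (2 * (s * N)) ≡ 16 * s * (x + N)
    lem₃ = solve-∀

  private
    correction : ∀ v → ∃ λ (c : Fin n → Bool) → ∑ (λ u → if adj G v u ∧ special u then [ c u ] else 0) ≡ target v ∸ (d v + D * heavy v)
    correction v = select (λ u → adj G v u ∧ special u) _ (begin
      target v ∸ (d v + D * heavy v)                            ≤⟨ ∸-monoˡ-≤ (d v + D * heavy v) (≤-trans (target≤nominal+2E v) (nominal+2E≤plan+specials v)) ⟩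
      d v + D * heavy v + specials v ∸ (d v + D * heavy v)      ≡⟨ m+n∸m≡n (d v + D * heavy v) (specials v) ⟩
      specials v ∎)
      where open ≤-Reasoning

  fix : Fin n → Fin n → ℕ
  fix v u = [ proj₁ (correction v) u ]

  corrected-weight : ∀ v → ∑ (λ u → if adj G v u then plan v u + (if special u then fix v u else 0) else 0) ≡ target v
  corrected-weight v = begin
    ∑ (λ u → if adj G v u then plan v u + (if special u then fix v u else 0) else 0)
      ≡⟨ ∑-cong (λ u → lem (adj G v u) (special u) (plan v u) (fix v u)) ⟩
    ∑ (λ u → (if adj G v u then plan v u else 0) + (if adj G v u ∧ special u then fix v u else 0))
      ≡⟨ ∑-+ (λ u → if adj G v u then plan v u else 0) (λ u → if adj G v u ∧ special u then fix v u else 0) ⟩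
    weight G plan v + ∑ (λ u → if adj G v u ∧ special u then fix v u else 0)
      ≡⟨ cong₂ _+_ (plan-weight v) (proj₂ (correction v)) ⟩
    d v + D * heavy v + (target v ∸ (d v + D * heavy v))
      ≡⟨ m+[n∸m]≡n (≤-trans (plan≤nominal v) (nominal≤target v)) ⟩
    target v ∎
    where
    open ≡-Reasoning
    lem : ∀ a b x y → (if a then x + (if b then y else 0) else 0) ≡ (if a then x else 0) + (if a ∧ b then y else 0)
    lem false b x y = refl
    lem true b x y = refl

  specialGraph : Graph n
  specialGraph = record
    { adj = λ u v → adj G u v ∧ (special u ∧ special v)
    ; sym = λ u v → cong₂ _∧_ (Graph.sym G u v) (∧-comm (special u) (special v))
    ; irrefl = λ v → cong (_∧ (special v ∧ special v)) (irrefl G v) }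

  -- Edges between special vertices get `suc (h u v)`, positive whatever `h` is; the constant 1 of
  -- each is booked here.
  outer : Fin n → ℕ
  outer v = ∑ (λ u → if adj G v u then (if special u then 1 else plan v u + fix u v) else 0)

  near? : Fin n → Fin n → Bool
  near? v u = special u ∧ near v (pos v) u (pos u)

  special-degree : ∀ v → special v ≡ true → # (adj specialGraph v) ≡ specials v
  special-degree v sv = ∑-cong {n} λ u → cong (λ c → [ adj G v u ∧ (c ∧ special u) ]) sv

  -- The lower digit in `reach` runs up to `T - 1`, and each of its units needs a special neighbour.
  T≤specials : ∀ v → T ≤ specials v
  T≤specials v = *-cancelˡ-≤ (2 * s) {{m*n≢0 2 s}} (begin
    2 * s * T              ≡⟨ *-assoc 2 s T ⟩
    2 * (s * T)            ≤⟨ 2sT≤δ ⟩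
    δ                      ≤⟨ min-degree v ⟩
    d v                    ≤⟨ specials-lower v ⟩
    2 * (s * specials v)   ≡⟨ *-assoc 2 s _ ⟨
    2 * s * specials v ∎)
    where open ≤-Reasoning

  -- Three forbidden values per near vertex times the 36 of `crowd-upper`: the origin of `108 ≤ L`.
  crowd-small : ∀ v → 3 * # (near? v) < L * suc (specials v)
  crowd-small v = begin-strict
    3 * # (near? v)            ≤⟨ *-monoʳ-≤ 3 (crowd-upper v) ⟩
    3 * (36 * specials v)      ≡⟨ *-assoc 3 36 (specials v) ⟨
    108 * specials v           ≤⟨ *-monoˡ-≤ (specials v) 108≤L ⟩
    L * specials v             <⟨ *-monoʳ-< L {{>-nonZero (≤-trans (s≤s z≤n) 108≤L)}} (n<1+n (specials v)) ⟩
    L * suc (specials v) ∎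
    where open ≤-Reasoning

  open Sequential specialGraph M L T LM≡T outer near? special
    (λ v sv → ≤-trans (T≤specials v) (≤-reflexive (sym (special-degree v sv))))
    (λ v sv → subst (λ z → 3 * # (near? v) < L * suc z) (sym (special-degree v sv)) (crowd-small v))
    using (sequential-weighting)

  private
    inner = sequential-weighting (s≤s (s≤s z≤n))
    h = proj₁ inner
    h-sym = proj₁ (proj₂ inner)
    h-bound = proj₁ (proj₂ (proj₂ inner))
    h-residue = proj₁ (proj₂ (proj₂ (proj₂ inner)))
    h-distinct = proj₂ (proj₂ (proj₂ (proj₂ inner)))

  f : Fin n → Fin n → ℕ
  f u v = if special u
    then (if special v then suc (h u v) else plan u v + fix v u)
    else plan u v + (if special v then fix u v else 0)

  by-cases : (P : Fin n → Fin n → ℕ → Set) →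
    (∀ u v → P u v (suc (h u v))) → (∀ u v → P u v (plan u v + fix v u)) → (∀ u v → P u v (plan u v + fix u v)) →
    (∀ u v → P u v (plan u v + 0)) → ∀ u v → P u v (f u v)
  by-cases P p₁ p₂ p₃ p₄ u v = go (special u) (special v)
    where
    go : ∀ su sv → P u v (if su then (if sv then suc (h u v) else plan u v + fix v u) else plan u v + (if sv then fix u v else 0))
    go true true = p₁ u v
    go true false = p₂ u v
    go false true = p₃ u v
    go false false = p₄ u v

  f-sym : ∀ u v → f u v ≡ f v u
  f-sym u v = go (special u) (special v)
    where
    value : Bool → Bool → Fin n → Fin n → ℕ
    value su sv u v = if su then (if sv then suc (h u v) else plan u v + fix v u) else plan u v + (if sv then fix u v else 0)
    go : ∀ su sv → value su sv u v ≡ value sv su v u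
    go true true = cong suc (h-sym u v)
    go true false = cong (_+ fix v u) (plan-sym u v)
    go false true = cong (_+ fix u v) (plan-sym u v)
    go false false = cong (_+ 0) (plan-sym u v)

  f-positive : ∀ u v → 1 ≤ f u v
  f-positive = by-cases (λ _ _ w → 1 ≤ w) (λ _ _ → s≤s z≤n) (λ _ _ → s≤s z≤n) (λ _ _ → s≤s z≤n) (λ _ _ → s≤s z≤n)

  h≤ : ∀ u v → suc (h u v) ≤ D + 4
  h≤ u v = ≤-trans (s≤s (≤-trans (h-bound u v) 3T≤D)) (≤-reflexive (sym (+-suc D 3)))

  f-local : ∀ v u → f v u ≤ 2 + D * [ heavy? v u ] + (D + 3) * [ special u ]
  f-local v u = go (special v) (special u) (heavy? v u)
    where
    ordinary : ∀ hv y → y ≤ 1 → suc (if hv then D else 0) + y ≤ 2 + D * [ hv ] + (D + 3) * 0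
    ordinary hv y y≤1 = ≤-trans (+-monoʳ-≤ (suc (if hv then D else 0)) y≤1) (≤-reflexive (lem hv))
      where
      lem₀ : ∀ D → suc D + 1 ≡ 2 + D * 1 + (D + 3) * 0
      lem₀ = solve-∀
      lem₁ : ∀ D → 2 ≡ 2 + D * 0 + (D + 3) * 0
      lem₁ = solve-∀
      lem : ∀ hv → suc (if hv then D else 0) + 1 ≡ 2 + D * [ hv ] + (D + 3) * 0
      lem true = lem₀ D
      lem false = lem₁ D
    extra : ∀ hv y → y ≤ 1 → suc (if hv then D else 0) + y ≤ 2 + D * [ hv ] + (D + 3) * 1
    extra hv y y≤1 = ≤-trans (ordinary hv y y≤1) (+-monoʳ-≤ (2 + D * [ hv ]) (*-monoʳ-≤ (D + 3) z≤n))
    go : ∀ sv su hv → (if sv then (if su then suc (h v u) else suc (if hv then D else 0) + fix u v) else suc (if hv then D else 0) + (if su then fix v u else 0))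
      ≤ 2 + D * [ hv ] + (D + 3) * [ su ]
    go true true hv = ≤-trans (h≤ v u) (≤-trans (≤-reflexive (lem D)) (≤-trans (+-monoˡ-≤ ((D + 3) * 1) (s≤s (z≤n {1}))) (+-monoˡ-≤ ((D + 3) * 1) (m≤m+n 2 (D * [ hv ])))))
      where
      lem : ∀ D → D + 4 ≡ 1 + (D + 3) * 1
      lem = solve-∀
    go true false hv = ordinary hv (fix u v) ([]≤1 (proj₁ (correction u) v))
    go false true hv = extra hv (fix v u) ([]≤1 (proj₁ (correction v) u))
    go false false hv = ordinary hv 0 z≤n

  plan-fix≤ : ∀ v u y → y ≤ 1 → plan v u + y ≤ D + 4
  plan-fix≤ v u y y≤1 = go (heavy? v u)
    where
    go : ∀ hv → suc (if hv then D else 0) + y ≤ D + 4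
    go true = ≤-trans (+-monoʳ-≤ (suc D) (≤-trans y≤1 (s≤s z≤n))) (≤-reflexive (sym (+-suc D 3)))
    go false = ≤-trans (s≤s (≤-trans y≤1 (s≤s (z≤n {2})))) (m≤n+m 4 D)

  f-bounded : ∀ u v → f u v ≤ D + 4
  f-bounded = by-cases (λ _ _ w → w ≤ D + 4) h≤
    (λ u v → plan-fix≤ u v (fix v u) ([]≤1 (proj₁ (correction v) u))) (λ u v → plan-fix≤ u v (fix u v) ([]≤1 (proj₁ (correction u) v))) (λ u v → plan-fix≤ u v 0 z≤n)

  ordinary-weight : ∀ v → special v ≡ false → weight G f v ≡ target v
  ordinary-weight v sv = trans (∑-cong {n} λ u → cong (λ c → if adj G v u then
      (if c then (if special u then suc (h v u) else plan v u + fix u v) else plan v u + (if special u then fix v u else 0)) else 0) sv)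
    (corrected-weight v)

  special-weight : ∀ v → special v ≡ true → weight G f v ≡ outer v + weight specialGraph h v
  special-weight v sv = trans (∑-cong {n} λ u → trans (cong (λ c → if adj G v u then
      (if c then (if special u then suc (h v u) else plan v u + fix u v) else plan v u + (if special u then fix v u else 0)) else 0) sv)
      (trans (lem (adj G v u) (special u) (h v u) (plan v u + fix u v))
        (cong (λ c → (if adj G v u then (if special u then 1 else plan v u + fix u v) else 0) + (if adj G v u ∧ (c ∧ special u) then h v u else 0)) (sym sv))))
    (∑-+ (λ u → if adj G v u then (if special u then 1 else plan v u + fix u v) else 0) (λ u → if adj G v u ∧ (special v ∧ special u) then h v u else 0))
    where
    lem : ∀ a b x y → (if a then (if b then suc x else y) else 0) ≡ (if a then (if b then 1 else y) else 0) + (if a ∧ b then x else 0)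
    lem false b x y = refl
    lem true false x y = sym (+-identityʳ y)
    lem true true x y = refl

  private
    D≤κ : D ≤ κ
    D≤κ = ≤-trans (≤-trans (m≤m+n D 3) (m≤n*m (D + 3) 2)) (≤-trans 2D≤s (≤-trans (m≤n*m s 2) 2s≤κ))
    instance
      nzκ : NonZero κ
      nzκ = >-nonZero (≤-trans 1≤D D≤κ)

  deviation-≤ : ∀ x y z → κ * x ≤ κ * y + z → D * x ≤ D * y + z
  deviation-≤ x y z h = *-cancelˡ-≤ κ (begin
    κ * (D * x)            ≡⟨ lem κ D x ⟩
    D * (κ * x)            ≤⟨ *-monoʳ-≤ D h ⟩
    D * (κ * y + z)        ≡⟨ lem′ D κ y z ⟩
    κ * (D * y) + D * z    ≤⟨ +-monoʳ-≤ (κ * (D * y)) (*-monoˡ-≤ z D≤κ) ⟩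
    κ * (D * y) + κ * z    ≡⟨ *-distribˡ-+ κ (D * y) z ⟨
    κ * (D * y + z) ∎)
    where
    open ≤-Reasoning
    lem : ∀ a b c → a * (b * c) ≡ b * (a * c)
    lem = solve-∀
    lem′ : ∀ D κ y z → D * (κ * y + z) ≡ κ * (D * y) + D * z
    lem′ = solve-∀

  -- The purpose of `2 * (D + 3) ≤ s`: whatever happens on the edges towards special vertices moves
  -- the weight by at most `d v`.
  inner≤d : ∀ v → (D + 3) * specials v ≤ d v
  inner≤d v = *-cancelˡ-≤ 2 (≤-trans (≤-reflexive (sym (*-assoc 2 (D + 3) (specials v)))) (≤-trans (*-monoˡ-≤ (specials v) 2D≤s) (specials-upper v)))

  -- The 4 here is the width in `near`: 2 on each edge for the unit and a correction, `d v` for the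
  -- special neighbours, and `d v` for the deviation, since `D ≤ κ`.
  weight-upper : ∀ v → n * weight G f v ≤ D * d v * pos v + 4 * (n * d v)
  weight-upper v = begin
    n * weight G f v                                                  ≤⟨ *-monoʳ-≤ n (≤-trans (∑-mono λ u → lem (adj G v u) (heavy? v u) (special u) (f-local v u)) (≤-reflexive split)) ⟩
    n * (2 * d v + D * heavy v + (D + 3) * specials v)                ≤⟨ *-monoʳ-≤ n (+-monoʳ-≤ (2 * d v + D * heavy v) (inner≤d v)) ⟩
    n * (2 * d v + D * heavy v + d v)                                 ≡⟨ lem₁ n (d v) D (heavy v) ⟩
    D * (n * heavy v) + 3 * (n * d v)                                 ≤⟨ +-monoˡ-≤ (3 * (n * d v)) (deviation-≤ (n * heavy v) (d v * pos v) (n * d v) (heavy-upper v)) ⟩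
    D * (d v * pos v) + n * d v + 3 * (n * d v)                       ≡⟨ lem₂ D (d v) (pos v) (n * d v) ⟩
    D * d v * pos v + 4 * (n * d v) ∎
    where
    open ≤-Reasoning
    x y z : Fin n → ℕ
    x u = 2 * [ adj G v u ]
    y u = D * [ adj G v u ∧ heavy? v u ]
    z u = (D + 3) * [ adj G v u ∧ special u ]
    lem : ∀ a b c {w} → w ≤ 2 + D * [ b ] + (D + 3) * [ c ] → (if a then w else 0) ≤ 2 * [ a ] + D * [ a ∧ b ] + (D + 3) * [ a ∧ c ]
    lem false b c _ = z≤n
    lem true b c h = h
    split : ∑ (λ u → x u + y u + z u) ≡ 2 * d v + D * heavy v + (D + 3) * specials v
    split = trans (∑-+ (λ u → x u + y u) z) (cong₂ _+_ (trans (∑-+ x y) (cong₂ _+_ (∑-*ˡ 2 (λ u → [ adj G v u ])) (∑-*ˡ D (λ u → [ adj G v u ∧ heavy? v u ]))))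
      (∑-*ˡ (D + 3) (λ u → [ adj G v u ∧ special u ])))
    lem₁ : ∀ n d D Y → n * (2 * d + D * Y + d) ≡ D * (n * Y) + 3 * (n * d)
    lem₁ = solve-∀
    lem₂ : ∀ D d θ x → D * (d * θ) + x + 3 * x ≡ D * d * θ + 4 * x
    lem₂ = solve-∀

  weight-lower : ∀ v → D * d v * pos v ≤ n * weight G f v + 4 * (n * d v)
  weight-lower v = begin
    D * d v * pos v                                          ≡⟨ *-assoc D (d v) (pos v) ⟩
    D * (d v * pos v)                                        ≤⟨ deviation-≤ (d v * pos v) (n * heavy v) (n * d v) (heavy-lower v) ⟩
    D * (n * heavy v) + n * d v                              ≡⟨ lem₁ D n (heavy v) (d v) ⟩
    n * (D * heavy v) + n * d v                              ≤⟨ +-monoˡ-≤ (n * d v) (*-monoʳ-≤ n D-heavy≤) ⟩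
    n * (weight G f v + d v) + n * d v                       ≡⟨ lem₂ n (weight G f v) (d v) ⟩
    n * weight G f v + 2 * (n * d v)                         ≤⟨ +-monoʳ-≤ (n * weight G f v) (*-monoˡ-≤ (n * d v) (s≤s (s≤s (z≤n {2})))) ⟩
    n * weight G f v + 4 * (n * d v) ∎
    where
    open ≤-Reasoning
    local : ∀ u → D * [ heavy? v u ] ≤ f v u + D * [ special u ]
    local u = go (special v) (special u) (heavy? v u)
      where
      one≥ : ∀ hv → D * [ hv ] ≤ D * 1
      one≥ hv = *-monoʳ-≤ D ([]≤1 hv)
      planned : ∀ hv y → D * [ hv ] ≤ suc (if hv then D else 0) + y
      planned true y = ≤-trans (≤-reflexive (*-identityʳ D)) (≤-trans (n≤1+n D) (m≤m+n (suc D) y))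
      planned false y = ≤-trans (≤-reflexive (*-zeroʳ D)) z≤n
      go : ∀ sv su hv → D * [ hv ] ≤ (if sv then (if su then suc (h v u) else suc (if hv then D else 0) + fix u v) else suc (if hv then D else 0) + (if su then fix v u else 0)) + D * [ su ]
      go true true hv = ≤-trans (one≥ hv) (m≤n+m (D * 1) (suc (h v u)))
      go true false hv = ≤-trans (planned hv (fix u v)) (m≤m+n _ (D * 0))
      go false true hv = ≤-trans (one≥ hv) (m≤n+m (D * 1) _)
      go false false hv = ≤-trans (planned hv 0) (m≤m+n _ (D * 0))
    lem : ∀ a b c {w} → D * [ b ] ≤ w + D * [ c ] → D * [ a ∧ b ] ≤ (if a then w else 0) + D * [ a ∧ c ]
    lem false b c _ = ≤-reflexive refl
    lem true b c h = h
    D-heavy≤ : D * heavy v ≤ weight G f v + d v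
    D-heavy≤ = begin
      D * heavy v                                            ≡⟨ ∑-*ˡ D (λ u → [ adj G v u ∧ heavy? v u ]) ⟨
      ∑ (λ u → D * [ adj G v u ∧ heavy? v u ])               ≤⟨ ∑-mono (λ u → lem (adj G v u) (heavy? v u) (special u) (local u)) ⟩
      ∑ (λ u → (if adj G v u then f v u else 0) + D * [ adj G v u ∧ special u ])
                                                             ≡⟨ ∑-+ (λ u → if adj G v u then f v u else 0) (λ u → D * [ adj G v u ∧ special u ]) ⟩
      weight G f v + ∑ (λ u → D * [ adj G v u ∧ special u ]) ≡⟨ cong (weight G f v +_) (∑-*ˡ D (λ u → [ adj G v u ∧ special u ])) ⟩
      weight G f v + D * specials v                          ≤⟨ +-monoʳ-≤ (weight G f v) (≤-trans (*-monoˡ-≤ (specials v) (m≤m+n D 3)) (inner≤d v)) ⟩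
      weight G f v + d v ∎
    lem₁ : ∀ D n Y d → D * (n * Y) + n * d ≡ n * (D * Y) + n * d
    lem₁ = solve-∀
    lem₂ : ∀ n w d → n * (w + d) + n * d ≡ n * w + 2 * (n * d)
    lem₂ = solve-∀

  equal-weights-near : ∀ u v → weight G f u ≡ weight G f v → near v (pos v) u (pos u) ≡ true
  equal-weights-near u v e = cong₂ _∧_
    (dec-true (D * d u * pos u ℕ.≤? D * d v * pos v + 4 * (n * (d u + d v))) (close u v e (lem₁ n (d u) (d v) (D * d v * pos v))))
    (dec-true (D * d v * pos v ℕ.≤? D * d u * pos u + 4 * (n * (d u + d v))) (close v u (sym e) (lem₂ n (d u) (d v) (D * d u * pos u))))
    where
    lem₁ : ∀ n a b x → x + 4 * (n * b) + 4 * (n * a) ≡ x + 4 * (n * (a + b))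
    lem₁ = solve-∀
    lem₂ : ∀ n a b x → x + 4 * (n * a) + 4 * (n * b) ≡ x + 4 * (n * (a + b))
    lem₂ = solve-∀
    close : ∀ u v {r} → weight G f u ≡ weight G f v → D * d v * pos v + 4 * (n * d v) + 4 * (n * d u) ≡ r → D * d u * pos u ≤ r
    close u v {r} e r≡ = begin
      D * d u * pos u                                            ≤⟨ weight-lower u ⟩
      n * weight G f u + 4 * (n * d u)                           ≡⟨ cong (λ z → n * z + 4 * (n * d u)) e ⟩
      n * weight G f v + 4 * (n * d u)                           ≤⟨ +-monoˡ-≤ (4 * (n * d u)) (weight-upper v) ⟩
      D * d v * pos v + 4 * (n * d v) + 4 * (n * d u)            ≡⟨ r≡ ⟩
      r ∎
      where open ≤-Reasoning

  special-distinct : ∀ u v → toℕ u < toℕ v → special u ≡ true → special v ≡ true → weight G f u ≢ weight G f v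
  special-distinct u v u<v su sv e = h-distinct u v u<v su sv (cong₂ _∧_ su (equal-weights-near u v e))
    (trans (sym (special-weight u su)) (trans e (special-weight v sv)))

  ordinary-special : ∀ u v → special u ≡ false → special v ≡ true → weight G f u ≢ weight G f v
  ordinary-special u v su sv e = let r , β , res = h-residue v sv in
    target-residue u r β (trans (sym (ordinary-weight u su)) (trans e (trans (special-weight v sv) res)))

  f-injective : ∀ u v → weight G f u ≡ weight G f v → u ≡ v
  f-injective u v e = go (special u) (special v) refl refl
    where
    go : ∀ su sv → special u ≡ su → special v ≡ sv → u ≡ v
    go false false su sv = target-injective u v (trans (sym (ordinary-weight u su)) (trans e (ordinary-weight v sv)))
    go false true su sv = ⊥-elim (ordinary-special u v su sv e)
    go true false su sv = ⊥-elim (ordinary-special v u sv su (sym e))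
    go true true su sv = by-order (<-cmp (toℕ u) (toℕ v))
      where
      by-order : Tri (toℕ u < toℕ v) (toℕ u ≡ toℕ v) (toℕ v < toℕ u) → u ≡ v
      by-order (tri< lt _ _) = ⊥-elim (special-distinct u v lt su sv e)
      by-order (tri≈ _ eq _) = toℕ-injective eq
      by-order (tri> _ _ gt) = ⊥-elim (special-distinct v u gt sv su (sym e))

  irregular : IsIrregular G (D + 4) f
  irregular = (λ u v _ → f-sym u v , f-positive u v , f-bounded u v)
    , λ {u} {v} e → f-injective u v (trans (sym (wdeg-weight G f u)) (trans e (wdeg-weight G f v)))

-- The weighting for small minimum degree

digits-unique : ∀ {n} b .{{_ : NonZero b}} (a a′ : Fin n → ℕ) → (∀ i → a i < b) → (∀ i → a′ i < b) →
  ∑ (λ i → a i * b ^ toℕ i) ≡ ∑ (λ i → a′ i * b ^ toℕ i) → ∀ i → a i ≡ a′ i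
digits-unique {suc n} b a a′ a< a′< e = λ { zero → proj₂ split ; (suc i) → digits-unique b (a ∘ suc) (a′ ∘ suc) (a< ∘ suc) (a′< ∘ suc) (proj₁ split) i }
  where
  shape : ∀ (c : Fin (suc n) → ℕ) → ∑ (λ i → c i * b ^ toℕ i) ≡ ∑ (λ i → c (suc i) * b ^ toℕ i) * b + c zero
  shape c = trans (cong₂ _+_ (*-identityʳ (c zero)) (trans (∑-cong λ i → lem (c (suc i)) b (b ^ toℕ i)) (∑-*ʳ b (λ i → c (suc i) * b ^ toℕ i)))) (+-comm (c zero) _)
    where
    lem : ∀ x b y → x * (b * y) ≡ x * y * b
    lem = solve-∀
  split = euclid-unique b _ _ (a zero) (a′ zero) (a< zero) (a′< zero) (trans (sym (shape a)) (trans e (shape a′)))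

degree≤ : ∀ {n} (G : Graph n) v → # (adj G v) ≤ n
degree≤ {n} G v = ≤-trans (∑-bound (λ u → []≤1 (adj G v u))) (≤-reflexive (*-identityʳ n))

degree< : ∀ {n} (G : Graph n) v → # (adj G v) < n
degree< {n} G v = ≤-trans (count-< (adj G v) (λ _ → true) (λ _ _ → refl) v (irrefl G v) refl) (≤-reflexive (trans (∑-const n 1) (*-identityʳ n)))

-- In base b = n + 1, the digit of the weighted degree of v at position u is deg v if u = v, and at most 1 otherwise.
module PositionalWeighting {n : ℕ} (G : Graph n) (two≤ : ∀ v → 2 ≤ # (adj G v)) where

  b : ℕ
  b = suc n

  f : Fin n → Fin n → ℕ
  f u v = b ^ toℕ u + b ^ toℕ v

  digit : Fin n → Fin n → ℕ
  digit v u = if does (u ≟ᶠ v) then # (adj G v) else [ adj G v u ]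

  digit-self : ∀ v → digit v v ≡ # (adj G v)
  digit-self v = cong (λ c → if c then # (adj G v) else [ adj G v v ]) (dec-true (v ≟ᶠ v) refl)

  digit-other : ∀ v u → u ≢ v → digit v u ≡ [ adj G v u ]
  digit-other v u u≢v = cong (λ c → if c then # (adj G v) else [ adj G v u ]) (dec-false (u ≟ᶠ v) u≢v)

  digit<b : ∀ v u → digit v u < b
  digit<b v u = go (does (u ≟ᶠ v))
    where
    go : ∀ c → (if c then # (adj G v) else [ adj G v u ]) < b
    go true = s≤s (degree≤ G v)
    go false = s≤s (≤-trans (≤-trans ([]≤1 (adj G v u)) (s≤s z≤n)) (≤-trans (two≤ v) (degree≤ G v)))

  weight-digits : ∀ v → weight G f v ≡ ∑ (λ u → digit v u * b ^ toℕ u)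
  weight-digits v = begin
    weight G f v
      ≡⟨ ∑-cong (λ u → lem (adj G v u) (b ^ toℕ v) (b ^ toℕ u)) ⟩
    ∑ (λ u → [ adj G v u ] * b ^ toℕ v + [ adj G v u ] * b ^ toℕ u)
      ≡⟨ ∑-+ (λ u → [ adj G v u ] * b ^ toℕ v) (λ u → [ adj G v u ] * b ^ toℕ u) ⟩
    ∑ (λ u → [ adj G v u ] * b ^ toℕ v) + ∑ (λ u → [ adj G v u ] * b ^ toℕ u)
      ≡⟨ cong (_+ ∑ (λ u → [ adj G v u ] * b ^ toℕ u)) (trans (∑-*ʳ (b ^ toℕ v) (λ u → [ adj G v u ])) (cong (_* b ^ toℕ v) (sym (digit-self v)))) ⟩
    digit v v * b ^ toℕ v + ∑ (λ u → [ adj G v u ] * b ^ toℕ u)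
      ≡⟨ ∑-update (λ u → [ adj G v u ] * b ^ toℕ u) (λ u → digit v u * b ^ toℕ u) v (λ u u≢v → cong (_* b ^ toℕ u) (sym (digit-other v u u≢v))) ⟨
    [ adj G v v ] * b ^ toℕ v + ∑ (λ u → digit v u * b ^ toℕ u)
      ≡⟨ cong (λ c → [ c ] * b ^ toℕ v + ∑ (λ u → digit v u * b ^ toℕ u)) (irrefl G v) ⟩
    ∑ (λ u → digit v u * b ^ toℕ u) ∎
    where
    open ≡-Reasoning
    lem : ∀ a x y → (if a then x + y else 0) ≡ [ a ] * x + [ a ] * y
    lem false x y = refl
    lem true x y = sym (cong₂ _+_ (+-identityʳ x) (+-identityʳ y))

  f-injective : ∀ u v → weight G f u ≡ weight G f v → u ≡ v
  f-injective u v e = go (u ≟ᶠ v)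
    where
    same : digit u u ≡ digit v u
    same = digits-unique b (digit u) (digit v) (digit<b u) (digit<b v) (trans (sym (weight-digits u)) (trans e (weight-digits v))) u
    go : Dec (u ≡ v) → u ≡ v
    go (yes u≡v) = u≡v
    go (no u≢v) = ⊥-elim (<⇒≱ (s≤s ([]≤1 (adj G v u))) (≤-trans (two≤ u) (≤-reflexive (trans (sym (digit-self u)) (trans same (digit-other v u u≢v))))))

  irregular : ∀ k → 2 * b ^ n ≤ k → IsIrregular G k f
  irregular k k≥ = (λ u v _ → +-comm (b ^ toℕ u) (b ^ toℕ v)
      , ≤-trans (m^n>0 b (toℕ u)) (m≤m+n (b ^ toℕ u) (b ^ toℕ v))
      , ≤-trans (+-mono-≤ (^-monoʳ-≤ b (<⇒≤ (toℕ<n u))) (≤-trans (^-monoʳ-≤ b (<⇒≤ (toℕ<n v))) (≤-reflexive (sym (+-identityʳ _))))) k≥)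
    , λ {u} {v} e → f-injective u v (trans (sym (wdeg-weight G f u)) (trans e (wdeg-weight G f v)))

-- Powers of two against polynomials

^-cancelˡ-≤ : ∀ a b k .{{_ : NonZero k}} → a ^ k ≤ b ^ k → a ≤ b
^-cancelˡ-≤ a b k h with a ℕ.≤? b
... | yes a≤b = a≤b
... | no a≰b = ⊥-elim (<⇒≱ (^-monoˡ-< k (≰⇒> a≰b)) h)

linear≤exponential : ∀ a u → 2 * a ≤ u → a * u ≤ 2 ^ u
linear≤exponential a u 2a≤u with m≤n⇒∃[o]m+o≡n 2a≤u
... | w , refl = begin
    a * (2 * a + w)             ≤⟨ *-monoʳ-≤ a (≤-trans (m≤m+n _ w) (≤-reflexive (lem a w))) ⟩
    a * (2 * (a + w))           ≤⟨ *-mono-≤ (<⇒≤ (n<2^n a)) (double (a + w)) ⟩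
    2 ^ a * 2 ^ (a + w)         ≡⟨ ^-distribˡ-+-* 2 a (a + w) ⟨
    2 ^ (a + (a + w))           ≡⟨ cong (2 ^_) (lem′ a w) ⟩
    2 ^ (2 * a + w) ∎
  where
  open ≤-Reasoning
  n<2^n : ∀ n → n < 2 ^ n
  n<2^n zero = s≤s z≤n
  n<2^n (suc n) = ≤-trans (+-mono-≤ (m^n>0 2 n) (n<2^n n)) (≤-reflexive (cong (2 ^ n +_) (sym (+-identityʳ (2 ^ n)))))
  double : ∀ n → 2 * n ≤ 2 ^ n
  double zero = z≤n
  double (suc n) = *-monoʳ-≤ 2 (n<2^n n)
  lem : ∀ a w → 2 * a + w + w ≡ 2 * (a + w)
  lem = solve-∀
  lem′ : ∀ a w → a + (a + w) ≡ 2 * a + w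
  lem′ = solve-∀

-- With `u = t / q` the base is at most linear in `u`, hence at most `2 ^ u`, and
-- `2 ^ (u * q) ≤ 2 ^ t`. For `2 ^ t ≤ δ` it says that a multiple of the logarithm is at most the
-- `q`-th root of `δ`.
polynomial≤exponential : ∀ K q .{{_ : NonZero K}} .{{_ : NonZero q}} → ∃ λ t₀ → ∀ t → t₀ ≤ t → (K * (4 * t + 7)) ^ q ≤ 2 ^ t
polynomial≤exponential K q = 2 * a * q , λ t t₀≤t → bound t t₀≤t
  where
  open ≤-Reasoning
  a = 2 * (K * (4 * q + 7))
  lem : ∀ u q → 4 * (suc u * q) + 7 + 7 * u ≡ (4 * q + 7) * suc u
  lem = solve-∀
  lem′ : ∀ K x u → K * (x * (2 * u)) ≡ 2 * (K * x) * u
  lem′ = solve-∀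
  lem″ : ∀ q → 4 * q + 7 ≡ suc (4 * q + 6)
  lem″ q = +-suc (4 * q) 6
  bound : ∀ t → 2 * a * q ≤ t → (K * (4 * t + 7)) ^ q ≤ 2 ^ t
  bound t t₀≤t = begin
    (K * (4 * t + 7)) ^ q       ≤⟨ ^-monoˡ-≤ q (begin
      K * (4 * t + 7)             ≤⟨ *-monoʳ-≤ K (+-monoˡ-≤ 7 (*-monoʳ-≤ 4 (<⇒≤ (/-ceil t q)))) ⟩
      K * (4 * (suc u * q) + 7)   ≤⟨ *-monoʳ-≤ K (≤-trans (m≤m+n _ (7 * u)) (≤-reflexive (lem u q))) ⟩
      K * ((4 * q + 7) * suc u)   ≤⟨ *-monoʳ-≤ K (*-monoʳ-≤ (4 * q + 7) (≤-trans (+-monoˡ-≤ u 1≤u) (≤-reflexive (cong (u +_) (sym (+-identityʳ u)))))) ⟩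
      K * ((4 * q + 7) * (2 * u)) ≡⟨ lem′ K (4 * q + 7) u ⟩
      a * u                       ≤⟨ linear≤exponential a u 2a≤u ⟩
      2 ^ u ∎) ⟩
    (2 ^ u) ^ q                 ≡⟨ ^-*-assoc 2 u q ⟩
    2 ^ (u * q)                 ≤⟨ ^-monoʳ-≤ 2 (/-floor t q) ⟩
    2 ^ t ∎
    where
    u = t / q
    2a≤u : 2 * a ≤ u
    2a≤u = ≤-pred (*-cancelʳ-< q _ _ (≤-trans (s≤s t₀≤t) (/-ceil t q)))
    1≤u : 1 ≤ u
    1≤u = ≤-trans (*-mono-≤ {1} {2} {1} {a} (s≤s z≤n) (*-mono-≤ {1} {2} (s≤s z≤n) (*-mono-≤ (>-nonZero⁻¹ K) (≤-trans (s≤s z≤n) (≤-reflexive (sym (lem″ q))))))) 2a≤u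

binary-size : ∀ x → 1 ≤ x → ∃ λ t → 2 ^ t ≤ x × x < 2 ^ suc t
binary-size (suc zero) _ = 0 , s≤s z≤n , s≤s (s≤s z≤n)
binary-size (suc (suc x)) _ with binary-size (suc x) (s≤s z≤n)
... | t , lo , hi with suc (suc x) ℕ.<? 2 ^ suc t
...   | yes lt = t , m≤n⇒m≤1+n lo , lt
...   | no nlt = suc t , ≮⇒≥ nlt , ≤-trans (s≤s hi) (≤-trans (≤-reflexive (+-comm 1 _)) (≤-trans (+-monoʳ-≤ (2 ^ suc t) (m^n>0 2 (suc t))) (≤-reflexive (cong (2 ^ suc t +_) (sym (+-identityʳ _))))))

-- The choice of the parameters

module Parameters (L : ℕ) (108≤L : 108 ≤ L) {n : ℕ} .{{_ : NonZero n}} (G : Graph n) (δ : ℕ) .{{_ : NonZero δ}}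
  (min-degree : ∀ v → δ ≤ # (adj G v)) where

  private instance
    nzL : NonZero L
    nzL = >-nonZero (≤-trans (s≤s z≤n) 108≤L)
    nz3L : NonZero (3 * L)
    nz3L = m*n≢0 3 L

  r M₄ M T D s κ R : ℕ
  r = n / δ
  -- The least value with `r < 3 * L * M₄`: as `D = 3 * L * M`, the condition `sparse` reduces to
  -- `n ≤ 3 * L * M₄ * δ`.
  M₄ = suc (r / (3 * L))
  M = 4 + M₄
  T = L * M
  D = 3 * T
  s = 3 * D
  κ = 16 * (D * s)
  R = r ⊔ 1

  private
    1≤δ : 1 ≤ δ
    1≤δ = >-nonZero⁻¹ δ
    M≤T : M ≤ T
    M≤T = m≤n*m M L
    T≤D : T ≤ D
    T≤D = m≤n*m T 3
    6≤T : 6 ≤ T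
    6≤T = *-mono-≤ {6} {L} {1} (≤-trans (s≤s (s≤s (s≤s (s≤s (s≤s (s≤s z≤n)))))) 108≤L) (s≤s (z≤n {3 + M₄}))
    6≤D : 6 ≤ D
    6≤D = ≤-trans 6≤T T≤D
    D≤s : D ≤ s
    D≤s = m≤n*m D 3
    instance
      nzD : NonZero D
      nzD = >-nonZero (≤-trans (s≤s z≤n) 6≤D)
      nzT : NonZero T
      nzT = >-nonZero (≤-trans (s≤s z≤n) 6≤T)
      nzs : NonZero s
      nzs = >-nonZero (≤-trans (s≤s z≤n) (≤-trans 6≤D D≤s))
      nzκ : NonZero κ
      nzκ = m*n≢0 16 (D * s) {{_}} {{m*n≢0 D s}}
      nz16sM : NonZero (16 * (s * M))
      nz16sM = m*n≢0 16 (s * M) {{_}} {{m*n≢0 s M}}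

  n<[1+r]δ : n < suc r * δ
  n<[1+r]δ = /-ceil n δ

  1+r≤3LM₄ : suc r ≤ 3 * L * M₄
  1+r≤3LM₄ = ≤-trans (/-ceil r (3 * L)) (≤-reflexive (*-comm M₄ (3 * L)))

  sparse : n * M ≤ D * M₄ * δ
  sparse = begin
    n * M                   ≤⟨ *-monoˡ-≤ M (<⇒≤ n<[1+r]δ) ⟩
    suc r * δ * M           ≤⟨ *-monoˡ-≤ M (*-monoˡ-≤ δ 1+r≤3LM₄) ⟩
    3 * L * M₄ * δ * M      ≡⟨ lem L M₄ δ M ⟩
    D * M₄ * δ ∎
    where
    open ≤-Reasoning
    lem : ∀ L M₄ δ M → 3 * L * M₄ * δ * M ≡ 3 * (L * M) * M₄ * δ
    lem = solve-∀

  -- Here `D = 3 * L * (5 + r / (3 * L))`. The 5, made of the 4 in `M` and the rounding in `M₄`,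
  -- produces `15 * L`; the remainder is at most `n / δ`.
  strength-bound : (D + 4) * δ ≤ n + (15 * L + 4) * δ
  strength-bound = begin
    (D + 4) * δ                                              ≡⟨ lem₁ L (r / (3 * L)) δ ⟩
    r / (3 * L) * (3 * L) * δ + (15 * L + 4) * δ             ≤⟨ +-monoˡ-≤ ((15 * L + 4) * δ) (≤-trans (*-monoˡ-≤ δ (/-floor r (3 * L))) (/-floor n δ)) ⟩
    n + (15 * L + 4) * δ ∎
    where
    open ≤-Reasoning
    lem₁ : ∀ L x δ → (3 * (L * (5 + x)) + 4) * δ ≡ x * (3 * L) * δ + (15 * L + 4) * δ
    lem₁ = solve-∀

  scale : ℕ
  scale = 16 * (18 * L * (3 * (18 * L)))

  κ≤ : κ ≤ scale * (R * R)
  κ≤ = begin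
    16 * (D * (3 * D))                                    ≤⟨ *-monoʳ-≤ 16 (*-mono-≤ D≤ (*-monoʳ-≤ 3 D≤)) ⟩
    16 * (18 * L * R * (3 * (18 * L * R)))                ≡⟨ lem (18 * L) R ⟩
    scale * (R * R) ∎
    where
    open ≤-Reasoning
    M≤ : M ≤ 6 * R
    M≤ = ≤-trans (+-monoʳ-≤ 5 (≤-trans (m/n≤m r (3 * L)) (m≤m⊔n r 1))) (≤-trans (≤-reflexive (+-comm 5 R)) (+-monoʳ-≤ R (*-monoʳ-≤ 5 (m≤n⊔m r 1))))
    D≤ : D ≤ 18 * L * R
    D≤ = ≤-trans (*-monoʳ-≤ 3 (*-monoʳ-≤ L M≤)) (≤-reflexive (lem₁ L R))
      where
      lem₁ : ∀ L R → 3 * (L * (6 * R)) ≡ 18 * L * R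
      lem₁ = solve-∀
    lem : ∀ Z R → 16 * (Z * R * (3 * (Z * R))) ≡ 16 * (Z * (3 * Z)) * (R * R)
    lem = solve-∀

  irregular-weighting : ∀ g → 1 ≤ g → 6 * (n * n) ≤ 2 ^ g → 8 * (κ * κ * g) ≤ δ → ∃ λ f → IsIrregular G (D + 4) f
  irregular-weighting g 1≤g constraints large = f , irregular
    where
    open ≤-Reasoning
    κ≤δ : κ ≤ δ
    κ≤δ = ≤-trans (≤-trans (m≤m*n κ κ) (≤-trans (m≤m*n (κ * κ) g {{>-nonZero 1≤g}}) (m≤n*m (κ * κ * g) 8))) large
    e : ℕ
    -- The largest window size for which `E` costs one unit of `δ / (16 * s)`. Since `e ≥ 1`,
    -- rounding loses at most a factor 2, and `δ≤κe` follows from `2 * M ≤ D`.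
    e = δ / (16 * (s * M))
    16sM≤δ : 16 * (s * M) ≤ δ
    16sM≤δ = ≤-trans (*-monoʳ-≤ 16 (≤-trans (*-monoʳ-≤ s (≤-trans M≤T T≤D)) (≤-reflexive (*-comm s D)))) κ≤δ
    1≤e : 1 ≤ e
    1≤e = m≥n⇒m/n>0 16sM≤δ
    instance
      nze : NonZero e
      nze = >-nonZero 1≤e
    16sE≤δ : 16 * (s * (M * e)) ≤ δ
    16sE≤δ = ≤-trans (≤-reflexive (lem s M e)) (/-floor δ (16 * (s * M)))
      where
      lem : ∀ s M e → 16 * (s * (M * e)) ≡ e * (16 * (s * M))
      lem = solve-∀
    E≤δ : M * e ≤ δ
    E≤δ = ≤-trans (≤-trans (m≤n*m (M * e) s) (m≤n*m (s * (M * e)) 16)) 16sE≤δ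
    δ≤κe : δ ≤ κ * e
    δ≤κe = begin
      δ                                   ≤⟨ <⇒≤ (/-ceil δ (16 * (s * M))) ⟩
      suc e * (16 * (s * M))              ≤⟨ *-monoˡ-≤ (16 * (s * M)) (+-monoˡ-≤ e 1≤e) ⟩
      (e + e) * (16 * (s * M))            ≡⟨ lem e s M ⟩
      16 * (2 * M * s) * e                ≤⟨ *-monoˡ-≤ e (*-monoʳ-≤ 16 (*-monoˡ-≤ s (*-mono-≤ {2} {3} (s≤s (s≤s z≤n)) M≤T))) ⟩
      16 * (D * s) * e ∎
      where
      lem : ∀ e s M → (e + e) * (16 * (s * M)) ≡ 16 * (2 * M * s) * e
      lem = solve-∀
    open Assembly G δ M₄ e D s κ g L T 1≤δ (≤-trans (s≤s z≤n) 6≤D) min-degree (*-monoʳ-≤ 3 6≤D)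
      (≤-trans (*-monoˡ-≤ s (≤-trans (s≤s (s≤s z≤n)) 6≤D)) (m≤n*m (D * s) 16))
      E≤δ δ≤κe sparse constraints large refl 108≤L (≤-reflexive (trans (*-suc 3 T) (+-comm 3 D)))
      (≤-trans (≤-reflexive (*-distribˡ-+ 2 D 3)) (≤-trans (+-monoʳ-≤ (2 * D) 6≤D) (≤-reflexive (+-comm (2 * D) D))))
      refl 16sE≤δ
      (≤-trans (*-mono-≤ {4} {16} (s≤s (s≤s (s≤s (s≤s z≤n)))) (m≤n*m s D)) κ≤δ)
      (≤-trans (*-mono-≤ {2} {16} (s≤s (s≤s z≤n)) (≤-trans (*-monoʳ-≤ s T≤D) (≤-reflexive (*-comm s D)))) κ≤δ)

-- The degree threshold and the final constant

module Strength (L : ℕ) (108≤L : 108 ≤ L) (p q : ℕ) (4p<q : 4 * p < q) where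

  private
    scale = 16 * (18 * L * (3 * (18 * L)))
    K = 8 * (scale * scale)
    1≤q : 1 ≤ q
    1≤q = ≤-trans (s≤s z≤n) 4p<q
    p≤q : p ≤ q
    p≤q = ≤-trans (m≤n*m p 4) (<⇒≤ 4p<q)
    1≤18L : 1 ≤ 18 * L
    1≤18L = *-mono-≤ {1} {18} (s≤s z≤n) (≤-trans (s≤s z≤n) 108≤L)
    1≤scale : 1 ≤ scale
    1≤scale = *-mono-≤ {1} {16} (s≤s z≤n) (*-mono-≤ 1≤18L (*-mono-≤ {1} {3} (s≤s z≤n) 1≤18L))
    instance
      nzq : NonZero q
      nzq = >-nonZero 1≤q
      nzK : NonZero K
      nzK = >-nonZero (*-mono-≤ {1} {8} (s≤s z≤n) (*-mono-≤ 1≤scale 1≤scale))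
    threshold : ∃ λ t₀ → ∀ t → t₀ ≤ t → (K * (4 * t + 7)) ^ q ≤ 2 ^ t
    threshold = polynomial≤exponential K q
    t₀ δ₀ smallStrength : ℕ
    t₀ = proj₁ threshold
    δ₀ = 2 ^ t₀
    smallStrength = 2 * suc (δ₀ * δ₀) ^ (δ₀ * δ₀)

  C : ℕ
  C = smallStrength + (15 * L + 4)

  C-positive : 0 < C
  C-positive = ≤-trans (≤-trans (s≤s z≤n) (m≤n+m 4 (15 * L))) (m≤n+m (15 * L + 4) smallStrength)

  module _ {n : ℕ} (G : Graph n) (δ : ℕ) (min-degree : ∀ v → δ ≤ # (adj G v)) (v₀ : Fin n) (n^q≤ : n ^ q ≤ δ ^ (q + p)) where

    private
      δ<n : δ < n
      δ<n = ≤-trans (s≤s (min-degree v₀)) (degree< G v₀)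
      n≤n^q : n ≤ n ^ q
      n≤n^q = ≤-trans (≤-reflexive (sym (^-identityʳ n))) (^-monoʳ-≤ n {{>-nonZero (≤-trans (s≤s z≤n) δ<n)}} 1≤q)
      -- For `δ ≤ 1` the hypothesis would give `n ≤ δ`, while degrees are below `n`.
      -- `PositionalWeighting` relies on this bound.
      2≤δ : 2 ≤ δ
      2≤δ = ≰⇒> λ δ≤1 → <⇒≱ δ<n (≤-trans n≤n^q (≤-trans n^q≤ (small δ δ≤1)))
        where
        small : ∀ x → x ≤ 1 → x ^ (q + p) ≤ x
        small zero _ = ≤-reflexive (lem (q + p) (≤-trans 1≤q (m≤m+n q p)))
          where
          lem : ∀ k → 1 ≤ k → 0 ^ k ≡ 0
          lem (suc k) _ = refl
        small (suc zero) _ = ≤-reflexive (^-zeroˡ (q + p))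
        small (suc (suc x)) (s≤s ())
      instance
        nzn : NonZero n
        nzn = >-nonZero (≤-trans (s≤s z≤n) δ<n)
        nzδ : NonZero δ
        nzδ = >-nonZero (≤-trans (s≤s z≤n) 2≤δ)
      1≤δ : 1 ≤ δ
      1≤δ = ≤-trans (s≤s z≤n) 2≤δ
      n≤δδ : n ≤ δ * δ
      n≤δδ = ^-cancelˡ-≤ n (δ * δ) q (≤-trans n^q≤ (≤-trans (^-monoʳ-≤ δ (+-monoʳ-≤ q p≤q))
        (≤-reflexive (trans (^-distribˡ-+-* δ q q) (sym (^-distribʳ-* δ δ q))))))

    open Parameters L 108≤L G δ min-degree using (r; R; D; κ; κ≤; irregular-weighting; strength-bound)

    private
      r^q≤ : r ^ q ≤ δ ^ p
      r^q≤ = *-cancelʳ-≤ (r ^ q) (δ ^ p) (δ ^ q) {{m^n≢0 δ q}} (begin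
        r ^ q * δ ^ q       ≡⟨ ^-distribʳ-* r δ q ⟨
        (r * δ) ^ q         ≤⟨ ^-monoˡ-≤ q (/-floor n δ) ⟩
        n ^ q               ≤⟨ n^q≤ ⟩
        δ ^ (q + p)         ≡⟨ trans (cong (δ ^_) (+-comm q p)) (^-distribˡ-+-* δ p q) ⟩
        δ ^ p * δ ^ q ∎)
        where open ≤-Reasoning

      R^q≤ : R ^ q ≤ δ ^ p
      R^q≤ = max r r^q≤
        where
        max : ∀ x → x ^ q ≤ δ ^ p → (x ⊔ 1) ^ q ≤ δ ^ p
        max zero _ = ≤-trans (≤-reflexive (^-zeroˡ q)) (m^n>0 δ p)
        max (suc x) h = subst (λ z → suc z ^ q ≤ δ ^ p) (sym (⊔-identityʳ x)) h

      -- This is where `4 * p < q` enters: it leaves one factor `δ` over, which pays for the `q`-th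
      -- power of the logarithmic factor `K * g`.
      R⁴≤ : (R * R * (R * R)) ^ q ≤ δ ^ pred q
      R⁴≤ = begin
        (R * R * (R * R)) ^ q       ≡⟨ cong (_^ q) (lem R) ⟩
        (R ^ 4) ^ q                 ≡⟨ trans (^-*-assoc R 4 q) (trans (cong (R ^_) (*-comm 4 q)) (sym (^-*-assoc R q 4))) ⟩
        (R ^ q) ^ 4                 ≤⟨ ^-monoˡ-≤ 4 R^q≤ ⟩
        (δ ^ p) ^ 4                 ≡⟨ trans (^-*-assoc δ p 4) (cong (δ ^_) (*-comm p 4)) ⟩
        δ ^ (4 * p)                 ≤⟨ ^-monoʳ-≤ δ (≤-pred (≤-trans 4p<q (≤-reflexive (sym (suc-pred q))))) ⟩
        δ ^ pred q ∎
        where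
        open ≤-Reasoning
        lem : ∀ R → R * R * (R * R) ≡ R * (R * (R * (R * 1)))
        lem = solve-∀

      large-case : ∀ t → t₀ ≤ t → 2 ^ t ≤ δ → δ < 2 ^ suc t → ∃ λ f → IsIrregular G (D + 4) f
      large-case t t₀≤t 2^t≤δ δ<2^t+1 = irregular-weighting (4 * t + 7) (≤-trans (s≤s z≤n) (m≤n+m 7 (4 * t))) constraints large
        where
        open ≤-Reasoning
        w = suc t + suc t
        n≤2^w : n ≤ 2 ^ w
        n≤2^w = ≤-trans n≤δδ (≤-trans (*-mono-≤ (<⇒≤ δ<2^t+1) (<⇒≤ δ<2^t+1)) (≤-reflexive (sym (^-distribˡ-+-* 2 (suc t) (suc t)))))
        -- Origin of `4 * t + 7`: `n ≤ δ * δ < 2 ^ (2 * t + 2)`, so `n * n` contributes `4 * t + 4`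
        -- to the exponent and the factor 6 another 3.
        constraints : 6 * (n * n) ≤ 2 ^ (4 * t + 7)
        constraints = begin
          6 * (n * n)                ≤⟨ *-mono-≤ {6} {2 ^ 3} (s≤s (s≤s (s≤s (s≤s (s≤s (s≤s z≤n)))))) (*-mono-≤ n≤2^w n≤2^w) ⟩
          2 ^ 3 * (2 ^ w * 2 ^ w)    ≡⟨ cong (2 ^ 3 *_) (^-distribˡ-+-* 2 w w) ⟨
          2 ^ 3 * 2 ^ (w + w)        ≡⟨ ^-distribˡ-+-* 2 3 (w + w) ⟨
          2 ^ (3 + (w + w))          ≡⟨ cong (2 ^_) (lem t) ⟩
          2 ^ (4 * t + 7) ∎
          where
          lem : ∀ t → 3 + (suc t + suc t + (suc t + suc t)) ≡ 4 * t + 7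
          lem = solve-∀
        g = 4 * t + 7
        large : 8 * (κ * κ * g) ≤ δ
        large = ≤-trans (*-monoʳ-≤ 8 (*-monoˡ-≤ g (*-mono-≤ κ≤ κ≤))) (≤-trans (≤-reflexive (lem scale (R * R) g))
          (^-cancelˡ-≤ (K * g * (R * R * (R * R))) δ q (begin
            (K * g * (R * R * (R * R))) ^ q          ≡⟨ ^-distribʳ-* (K * g) (R * R * (R * R)) q ⟩
            (K * g) ^ q * (R * R * (R * R)) ^ q      ≤⟨ *-mono-≤ (≤-trans (proj₂ threshold t t₀≤t) 2^t≤δ) R⁴≤ ⟩
            δ * δ ^ pred q                           ≡⟨ cong (δ ^_) (suc-pred q) ⟩
            δ ^ q ∎)))
          where
          lem : ∀ c x g → 8 * (c * x * (c * x) * g) ≡ 8 * (c * c) * g * (x * x)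
          lem = solve-∀

    result : Σ ℕ λ k → Σ (Fin n → Fin n → ℕ) λ f → (1 ≤ k) × IsIrregular G k f × (k * δ ≤ n + C * δ)
    result = go (δ ℕ.<? δ₀)
      where
      go : Dec (δ < δ₀) → Σ ℕ λ k → Σ (Fin n → Fin n → ℕ) λ f → (1 ≤ k) × IsIrregular G k f × (k * δ ≤ n + C * δ)
      go (yes δ<δ₀) = smallStrength , PositionalWeighting.f G two≤ , m^n≥1 , PositionalWeighting.irregular G two≤ smallStrength strong
        , ≤-trans (*-monoˡ-≤ δ (m≤m+n smallStrength (15 * L + 4))) (m≤n+m (C * δ) n)
        where
        two≤ : ∀ v → 2 ≤ # (adj G v)
        two≤ v = ≤-trans 2≤δ (min-degree v)
        n≤ : n ≤ δ₀ * δ₀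
        n≤ = ≤-trans n≤δδ (*-mono-≤ (<⇒≤ δ<δ₀) (<⇒≤ δ<δ₀))
        strong : 2 * suc n ^ n ≤ smallStrength
        strong = *-monoʳ-≤ 2 (≤-trans (^-monoˡ-≤ n (s≤s n≤)) (^-monoʳ-≤ (suc (δ₀ * δ₀)) n≤))
        m^n≥1 : 1 ≤ smallStrength
        m^n≥1 = *-mono-≤ {1} {2} (s≤s z≤n) (m^n>0 (suc (δ₀ * δ₀)) (δ₀ * δ₀))
      go (no δ≮δ₀) =
        let t , lo , hi = binary-size δ 1≤δ
            t₀≤t = ≮⇒≥ λ t<t₀ → <⇒≱ hi (≤-trans (^-monoʳ-≤ 2 t<t₀) (≮⇒≥ δ≮δ₀))
            f , irr = large-case t t₀≤t lo hi
        in D + 4 , f , ≤-trans (s≤s z≤n) (m≤n+m 4 D) , irr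
          , ≤-trans strength-bound (+-monoʳ-≤ n (*-monoˡ-≤ δ (m≤n+m (15 * L + 4) smallStrength)))

-- The exponent ε is `p / q`, and the degree hypothesis is raised to the power `q`. Rational
-- exponents suffice: a real ε below 1/4 lies below such a `p / q`, and for `δ ≥ 1` a larger
-- exponent only weakens the hypothesis.
irregularity-strength-bound : (L : ℕ) → 108 ≤ L → (p q : ℕ) → 0 < p → 4 * p < q →
    Σ ℕ λ C → (0 < C) ×
    ((n : ℕ) (G : Graph n) (δ : ℕ) → IsMinDegree G δ → n ^ q ≤ δ ^ (q + p) →
    Σ ℕ λ k → Σ (Fin n → Fin n → ℕ) λ f →
    (1 ≤ k) × IsIrregular G k f × (k * δ ≤ n + C * δ))
irregularity-strength-bound L 108≤L p q _ 4p<q = C , C-positive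
  , λ n G δ (min-degree , v , _) h → result G δ (λ u → ≤-trans (min-degree u) (≤-reflexive (wdeg-weight G (λ _ _ → 1) u))) v h
  where open Strength L 108≤L p q 4p<q

theorem3 : (p q : ℕ) → 0 < p → 4 * p < q →
    Σ ℕ λ C → (0 < C) ×
    ((n : ℕ) (G : Graph n) (δ : ℕ) → IsMinDegree G δ → n ^ q ≤ δ ^ (q + p) →
    Σ ℕ λ k → Σ (Fin n → Fin n → ℕ) λ f →
    (1 ≤ k) × IsIrregular G k f × (k * δ ≤ n + C * δ))
theorem3 = irregularity-strength-bound 108 ≤-refl
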